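{- Let $k,n$ be non-negative integers and let $p_1,\dots,p_{k+1}$ be primes with $p_i\equiv 3,5,7\pmod 8$ for each $1\le i\le k+1$. Then for every integer $j$ not divisible by $p_{k+1}$ and every $m\in\{0,1\}$, \[ \mathcal{J}^*_6\Big(3^m p_1^2p_2^2\cdots p_k^2\,p_{k+1}\big(8p_{k+1}n+8j+p_{k+1}\big)\Big)\equiv 0\pmod 2. \]
   Context: Let $q=e^{2\pi i\tau}$ with $\tau$ in the upper half-plane, and let $\eta(\tau)=q^{1/24}\prod_{n\ge1}(1-q^n)$ be the Dedekind eta function. The Hauptmodul of the Fricke group $\Gamma_0^*(6)$ is \[ j_6^*(\tau)=\left(\frac{\eta(\tau)\eta(3\tau)}{\eta(2\tau)\eta(6\tau)}\right)^6+6+2^6\left(\frac{\eta(2\tau)\eta(6\tau)}{\eta(\tau)\eta(3\tau)}\right)^6=\frac1q+\sum_{n\ge1}\mathcal{J}^*_6(n)q^n, \] and $\mathcal{J}^*_6(n)$ denotes its $n$-th Fourier coefficient (an integer). -}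

module Defs where

open import Data.Nat as ℕ using (ℕ; zero; suc; _∸_; _≡ᵇ_)
open import Data.Nat.Divisibility using (_∣?_)
open import Data.Nat.Primality using (Prime)
open import Data.Integer as ℤ using (ℤ; +_; -[1+_]; _+_; _*_; -_)
open import Data.Bool using (if_then_else_)
open import Data.Vec using (Vec; []; _∷_)
open import Data.Product using (_×_)
open import Data.Sum using (_⊎_)
open import Relation.Binary.PropositionalEquality using (_≡_)
open import Relation.Nullary.Decidable using (does)

Series : Set
Series = ℕ → ℤ

sumUpTo : ℕ → (ℕ → ℤ) → ℤ
sumUpTo zero    f = f 0
sumUpTo (suc n) f = sumUpTo n f + f (suc n)

infixl 7 _⊛_
_⊛_ : Series → Series → Series
(f ⊛ g) n = sumUpTo n (λ i → f i * g (n ∸ i))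

oneS : Series
oneS zero    = + 1
oneS (suc _) = + 0

_^ˢ_ : Series → ℕ → Series
f ^ˢ zero  = oneS
f ^ˢ suc r = f ⊛ (f ^ˢ r)

-- 1 - q^k   (used with k ≥ 1)
oneMinusQ^ : ℕ → Series
oneMinusQ^ k zero    = + 1
oneMinusQ^ k (suc n) = if suc n ≡ᵇ k then -[1+ 0 ] else + 0

-- 1 / (1 - q^k) = Σ_{i ≥ 0} q^{k i}   (used with k ≥ 1)
geomQ^ : ℕ → Series
geomQ^ k n = if does (k ∣? n) then + 1 else + 0

eulerTrunc : ℕ → ℕ → Series
eulerTrunc d zero    = oneS
eulerTrunc d (suc N) = eulerTrunc d N ⊛ oneMinusQ^ (d ℕ.* suc N)

eulerInvTrunc : ℕ → ℕ → Series
eulerInvTrunc d zero    = oneS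
eulerInvTrunc d (suc N) = eulerInvTrunc d N ⊛ geomQ^ (d ℕ.* suc N)

-- ∏_{n≥1} (1 - q^{d n}) = q^{-d/24} η(dτ); the coefficient of q^m only
-- depends on the factors with n ≤ m.
euler : ℕ → Series
euler d m = eulerTrunc d m m

eulerInv : ℕ → Series
eulerInv d m = eulerInvTrunc d m m

-- q · (η(τ)η(3τ) / (η(2τ)η(6τ)))^6
etaQuotA : Series
etaQuotA = (euler 1 ⊛ euler 3 ⊛ eulerInv 2 ⊛ eulerInv 6) ^ˢ 6

-- q^{-1} · (η(2τ)η(6τ) / (η(τ)η(3τ)))^6
etaQuotB : Series
etaQuotB = (euler 2 ⊛ euler 6 ⊛ eulerInv 1 ⊛ eulerInv 3) ^ˢ 6

-- 𝒥*₆(N): coefficient of q^N in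
--   j₆*(τ) = (η(τ)η(3τ)/(η(2τ)η(6τ)))^6 + 6 + 2^6 (η(2τ)η(6τ)/(η(τ)η(3τ)))^6
--          = q^{-1} etaQuotA + 6 + 64 q etaQuotB,
-- for every integer N (zero for N < -1).
J6* : ℤ → ℤ
J6* -[1+ zero ]  = etaQuotA 0
J6* -[1+ suc _ ] = + 0
J6* (+ zero)     = etaQuotA 1 + + 6
J6* (+ suc n)    = etaQuotA (suc (suc n)) + + 64 * etaQuotB n

Admissible : ℕ → Set
Admissible p = Prime p × (p ℕ.% 8 ≡ 3 ⊎ p ℕ.% 8 ≡ 5 ⊎ p ℕ.% 8 ≡ 7)

prodSq : ∀ {k} → Vec ℕ k → ℕ
prodSq []       = 1
prodSq (p ∷ ps) = p ℕ.* p ℕ.* prodSq ps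

{-# OPTIONS --safe #-}

-- Write fₙ = ∏ (1 - q^{nk}) and work modulo 2, where f₂ = f₁². Then q j₆* ≡ 1/(f₁f₃)⁶.
-- By a finite identity of Shanks, f₁³ is the theta series θ₁ = Σ q^{s(s+1)/2}, and f₃³ is θ₃ = θ₁(q³).
-- Pairing the representations of an integer by the form (s(s+1) + 3t(t+1))/2 gives θ₁θ₃ = θ₁⁴ + q θ₃⁴. Since an
-- 8th power is a series in q⁸, it follows that
--   1/(θ₁θ₃)² = (..)⁸ + q² θ₁⁸ + q⁴ θ₃⁸ + q⁶ (..)⁸,
-- so the coefficient of j₆* at N ≡ 1 (mod 8) is odd only if N is a square, and the one at N ≡ 3 (mod 8) only if N
-- is three times a square. The exponents of the theorem are ≡ 3^m (mod 8), and N / 3^m has odd p-adic valuation.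
module Submission where

open import Defs
open import Algebra.Bundles using (CommutativeRing; RawRing)
import Algebra.Properties.CommutativeSemigroup
import Algebra.Solver.Ring
open import Algebra.Solver.Ring.AlmostCommutativeRing using (fromCommutativeSemiring; _-Raw-AlmostCommutative⟶_)
open import Data.Bool as Bool using (Bool; true; false; not; _∧_; _xor_; if_then_else_)
import Data.Bool.Properties as Bool
open import Data.Integer as ℤ using (ℤ; +_; -[1+_]; _⊖_; ∣_∣)
import Data.Integer.Divisibility.Signed as Signed
import Data.Integer.Properties as ℤ
open import Data.Integer.Tactic.RingSolver using () renaming (solve-∀ to ℤ-solve-∀)
open import Data.Maybe using (Maybe; just; nothing)
open import Data.Nat as ℕ using (ℕ; zero; suc; _≤_; _<_; z≤n; s≤s; _≤ᵇ_; _≡ᵇ_; _∸_; _^_; _%_)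
open import Data.Nat.Divisibility as ℕ using (_∣?_)
import Data.Nat.DivMod as ℕ
open import Data.Nat.Induction using (<-rec)
open import Data.Nat.Primality using (Prime; euclidsLemma; prime⇒nonZero; prime⇒nonTrivial)
import Data.Nat.Properties as ℕ
open import Data.Nat.Tactic.RingSolver using (solve-∀)
open import Data.Product using (_,_; ∃)
open import Data.Sum using (_⊎_; inj₁; inj₂; [_,_]′)
open import Data.Vec using (Vec; []; _∷_)
open import Data.Vec.Relation.Unary.All using (All; []; _∷_)
open import Function using (id)
open import Function.Bundles using (mk⇔)
open import Level using (0ℓ)
import Relation.Binary.Reasoning.Setoid
open import Relation.Binary.PropositionalEquality as ≡ using (_≡_; _≢_; _≗_)
open import Relation.Nullary using (¬_; yes; no; contradiction)
open import Relation.Nullary.Decidable using (does; does-⇔; dec-true; dec-false)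
open import Relation.Nullary.Reflects using (ofʸ; ofⁿ)

-- The theta series for f₁³ comes from Gauss's identity f₂²/f₁ = Σ q^(s(s+1)/2), whose left side
-- becomes f₁³ modulo 2. Infinite sums and products are avoided by working modulo q^K, with K just
-- above the coefficient wanted. The theta identities are proved in any commutative ring of
-- characteristic 2 with a family of powers vanishing from K on. There every series is a sum of
-- length K, and reindexed sums keep that length because all further terms vanish. The dissection
-- rests on squaring being additive. For G = θ₁θ₃ the pairing identity gives G² = θ₁⁸ + q²θ₃⁸, and
-- 1/G² = G⁶/G⁸ turns this into a cube over an eighth power. Its four terms fall into the four even
-- residues modulo 8, and in the two middle ones the factor G⁸ = θ₁⁸θ₃⁸ cancels. Those two are
-- explicit theta series, which is why exactly the classes N ≡ 1 and N ≡ 3 (mod 8) come within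
-- reach, N being one less than the exponent in q j₆*. Squares enter since 8t + 1 = (2s+1)² when t =
-- s(s+1)/2.

n+n≡n*2 : ∀ n → n ℕ.+ n ≡ n ℕ.* 2
n+n≡n*2 = solve-∀

-- Triangular numbers

tri : ℕ → ℕ
tri zero    = 0
tri (suc n) = suc n ℕ.+ tri n

tri-*2 : ∀ n → tri n ℕ.* 2 ≡ n ℕ.* suc n
tri-*2 zero    = ≡.refl
tri-*2 (suc n) = ≡.trans (ℕ.*-distribʳ-+ 2 (suc n) (tri n)) (≡.trans (≡.cong (suc n ℕ.* 2 ℕ.+_) (tri-*2 n)) (lemma n))
  where
  lemma : ∀ n → suc n ℕ.* 2 ℕ.+ n ℕ.* suc n ≡ suc n ℕ.* suc (suc n)
  lemma = solve-∀

n≤tri[n] : ∀ n → n ≤ tri n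
n≤tri[n] zero    = z≤n
n≤tri[n] (suc n) = ℕ.m≤m+n (suc n) (tri n)

-- This and `tri-even` identify the two exponents that each induction step of `shanks` adds to the
-- theta sum.
tri-odd : ∀ n → tri (1 ℕ.+ n ℕ.* 2) ≡ suc n ℕ.* (1 ℕ.+ n ℕ.* 2)
tri-odd n = ℕ.*-cancelʳ-≡ _ _ 2 (≡.trans (tri-*2 (1 ℕ.+ n ℕ.* 2)) (lemma n))
  where
  lemma : ∀ n → (1 ℕ.+ n ℕ.* 2) ℕ.* suc (1 ℕ.+ n ℕ.* 2) ≡ suc n ℕ.* (1 ℕ.+ n ℕ.* 2) ℕ.* 2
  lemma = solve-∀

tri-even : ∀ n → tri (2 ℕ.+ n ℕ.* 2) ≡ suc n ℕ.* (3 ℕ.+ n ℕ.* 2)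
tri-even n = ℕ.*-cancelʳ-≡ _ _ 2 (≡.trans (tri-*2 (2 ℕ.+ n ℕ.* 2)) (lemma n))
  where
  lemma : ∀ n → (2 ℕ.+ n ℕ.* 2) ℕ.* suc (2 ℕ.+ n ℕ.* 2) ≡ suc n ℕ.* (3 ℕ.+ n ℕ.* 2) ℕ.* 2
  lemma = solve-∀

-- Commutative rings of characteristic 2 with a nilpotent variable

CharacteristicTwo : ∀ {c ℓ} → CommutativeRing c ℓ → Set ℓ
CharacteristicTwo R = 1# + 1# ≈ 0#
  where open CommutativeRing R

-- The powers of an element x with x^K = 0, given as a family indexed by the exponent. Substituting
-- x^d for x is then mere reindexing (`scale`), and identities between exponents transfer directly.
record PowersUpTo {c ℓ} (R : CommutativeRing c ℓ) (K : ℕ) (q : ℕ → CommutativeRing.Carrier R) : Set ℓ where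
  open CommutativeRing R
  field
    q-0   : q 0 ≈ 1#
    q-+   : ∀ m n → q (m ℕ.+ n) ≈ q m * q n
    q-nil : ∀ {k} → K ≤ k → q k ≈ 0#

module CharTwo {c ℓ} (R : CommutativeRing c ℓ) (1+1≈0 : CharacteristicTwo R) where
  open CommutativeRing R
  open Relation.Binary.Reasoning.Setoid setoid

  -- Coefficients in 𝔽₂ let the solver decide identities that hold only in characteristic 2.
  𝔽₂ : RawRing _ _
  𝔽₂ = record { Carrier = Bool ; _≈_ = _≡_ ; _+_ = _xor_ ; _*_ = _∧_ ; -_ = λ b → b ; 0# = false ; 1# = true }

  fromBool : Bool → Carrier
  fromBool b = if b then 1# else 0#

  fromBool-+ : ∀ a b → fromBool (a xor b) ≈ fromBool a + fromBool b
  fromBool-+ false b     = sym (+-identityˡ _)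
  fromBool-+ true  false = sym (+-identityʳ _)
  fromBool-+ true  true  = sym 1+1≈0

  fromBool-* : ∀ a b → fromBool (a ∧ b) ≈ fromBool a * fromBool b
  fromBool-* false b = sym (zeroˡ _)
  fromBool-* true  b = sym (*-identityˡ _)

  fromBool-morphism : 𝔽₂ -Raw-AlmostCommutative⟶ fromCommutativeSemiring commutativeSemiring
  fromBool-morphism = record
    { ⟦_⟧    = fromBool
    ; +-homo = fromBool-+
    ; *-homo = fromBool-*
    ; -‿homo = λ _ → refl
    ; 0-homo = refl
    ; 1-homo = refl
    }

  fromBool-≟ : ∀ a b → Maybe (fromBool a ≈ fromBool b)
  fromBool-≟ a b with a Bool.≟ b
  ... | yes ≡.refl = just refl
  ... | no _       = nothing

  open Algebra.Solver.Ring 𝔽₂ (fromCommutativeSemiring commutativeSemiring) fromBool-morphism fromBool-≟ public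
    using (solve; _:=_; con; _:+_; _:*_)

  -- Finite sums

  ∑ : ℕ → (ℕ → Carrier) → Carrier
  ∑ zero    f = 0#
  ∑ (suc n) f = f 0 + ∑ n (λ i → f (suc i))

  ∑-cong : ∀ n {f g} → (∀ i → f i ≈ g i) → ∑ n f ≈ ∑ n g
  ∑-cong zero    f≈g = refl
  ∑-cong (suc n) f≈g = +-cong (f≈g 0) (∑-cong n λ i → f≈g (suc i))

  ∑-zero : ∀ n {f} → (∀ i → f i ≈ 0#) → ∑ n f ≈ 0#
  ∑-zero zero    f≈0 = refl
  ∑-zero (suc n) f≈0 = trans (+-cong (f≈0 0) (∑-zero n λ i → f≈0 (suc i))) (+-identityˡ 0#)

  ∑-last : ∀ n f → ∑ (suc n) f ≈ ∑ n f + f n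
  ∑-last zero    f = +-comm (f 0) 0#
  ∑-last (suc n) f = trans (+-congˡ (∑-last n λ i → f (suc i))) (sym (+-assoc _ _ _))

  ∑-+ : ∀ n f g → ∑ n (λ i → f i + g i) ≈ ∑ n f + ∑ n g
  ∑-+ zero    f g = sym (+-identityˡ 0#)
  ∑-+ (suc n) f g = trans (+-congˡ (∑-+ n (λ i → f (suc i)) (λ i → g (suc i))))
    (solve 4 (λ a b c d → (a :+ b) :+ (c :+ d) := (a :+ c) :+ (b :+ d)) refl _ _ _ _)

  ∑-*ˡ : ∀ n x f → x * ∑ n f ≈ ∑ n (λ i → x * f i)
  ∑-*ˡ zero    x f = zeroʳ x
  ∑-*ˡ (suc n) x f = trans (distribˡ _ _ _) (+-congˡ (∑-*ˡ n x λ i → f (suc i)))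

  ∑-*ʳ : ∀ n x f → ∑ n f * x ≈ ∑ n (λ i → f i * x)
  ∑-*ʳ n x f = trans (*-comm _ x) (trans (∑-*ˡ n x f) (∑-cong n λ i → *-comm x (f i)))

  ∑-square : ∀ n f → ∑ n f * ∑ n f ≈ ∑ n (λ i → f i * f i)
  ∑-square zero    f = zeroˡ 0#
  ∑-square (suc n) f = trans
    (solve 2 (λ a b → (a :+ b) :* (a :+ b) := a :* a :+ b :* b) refl _ _)
    (+-congˡ (∑-square n λ i → f (suc i)))

  ∑-comm : ∀ m n f → ∑ m (λ i → ∑ n (f i)) ≈ ∑ n (λ j → ∑ m (λ i → f i j))
  ∑-comm zero    n f = sym (∑-zero n λ _ → refl)
  ∑-comm (suc m) n f = trans (+-congˡ (∑-comm m n λ i → f (suc i))) (sym (∑-+ n (f 0) _))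

  ∑-extend : ∀ m n {f} → (∀ i → n ≤ i → f i ≈ 0#) → ∑ (m ℕ.+ n) f ≈ ∑ n f
  ∑-extend zero    n f≈0 = refl
  ∑-extend (suc m) n f≈0 = trans (∑-last (m ℕ.+ n) _)
    (trans (+-cong (∑-extend m n f≈0) (f≈0 (m ℕ.+ n) (ℕ.m≤n+m n m))) (+-identityʳ _))

  ∑-shift : ∀ a n {f} → (∀ i → i < a → f i ≈ 0#) → (∀ i → n ≤ i → f i ≈ 0#) → ∑ n f ≈ ∑ n (λ i → f (a ℕ.+ i))
  ∑-shift zero    n     low high = refl
  ∑-shift (suc a) n {f} low high = begin
    -- Appending the zero term at `n` lets the zero term at 0 be dropped without changing the
    -- length.
    ∑ n f                       ≈⟨ ∑-extend 1 n high ⟨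
    f 0 + ∑ n (λ i → f (suc i)) ≈⟨ +-congʳ (low 0 (s≤s z≤n)) ⟩
    0# + ∑ n (λ i → f (suc i))  ≈⟨ +-identityˡ _ ⟩
    ∑ n (λ i → f (suc i))       ≈⟨ ∑-shift a n (λ i i<a → low (suc i) (s≤s i<a)) (λ i n≤i → high (suc i) (ℕ.m≤n⇒m≤1+n n≤i)) ⟩
    ∑ n (λ i → f (suc a ℕ.+ i)) ∎

  ∑-parity : ∀ n {f} → (∀ i → n ≤ i → f i ≈ 0#) → ∑ n f ≈ ∑ n (λ i → f (i ℕ.* 2)) + ∑ n (λ i → f (1 ℕ.+ i ℕ.* 2))
  ∑-parity n {f} high = trans (sym (∑-extend n n high)) (trans (reflexive (≡.cong (λ k → ∑ k f) (n+n≡n*2 n))) (double n f))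
    where
    double : ∀ n f → ∑ (n ℕ.* 2) f ≈ ∑ n (λ i → f (i ℕ.* 2)) + ∑ n (λ i → f (1 ℕ.+ i ℕ.* 2))
    double zero    f = sym (+-identityˡ 0#)
    double (suc n) f = trans (+-congˡ (+-congˡ (double n λ i → f (suc (suc i)))))
      (solve 4 (λ a b c d → a :+ (b :+ (c :+ d)) := (a :+ c) :+ (b :+ d)) refl _ _ _ _)

  -- Double sums over ℕ × ℕ of functions vanishing outside a triangle

  ∑∑ : ℕ → (ℕ → ℕ → Carrier) → Carrier
  ∑∑ n h = ∑ n λ a → ∑ n (h a)

  ∑∑-cong : ∀ n {g h} → (∀ a b → g a b ≈ h a b) → ∑∑ n g ≈ ∑∑ n h
  ∑∑-cong n g≈h = ∑-cong n λ a → ∑-cong n (g≈h a)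

  -- Plays the role of convergence: both indices may be re-parametrised by larger ones while each
  -- still ranges over the first `n` values.
  Triangular : ℕ → (ℕ → ℕ → Carrier) → Set ℓ
  Triangular n h = ∀ a b → n ≤ a ℕ.+ b → h a b ≈ 0#

  ∑∑-split : ∀ n {h} → Triangular n h →
    ∑∑ n h ≈ ∑∑ n (λ a e → h a (a ℕ.+ e)) + ∑∑ n (λ b e → h (suc b ℕ.+ e) b)
  ∑∑-split n {h} h-tri = begin
    ∑∑ n h                                              ≈⟨ ∑∑-cong n upper+lower ⟩
    ∑∑ n (λ a b → upper a b + lower a b)                ≈⟨ ∑-cong n (λ a → ∑-+ n (upper a) (lower a)) ⟩
    ∑ n (λ a → ∑ n (upper a) + ∑ n (lower a))           ≈⟨ ∑-+ n _ _ ⟩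
    -- A shift acts on the inner index. For `lower`, supported on a > b, that index must be a, hence
    -- the exchange of the two sums.
    ∑∑ n upper + ∑∑ n lower                             ≈⟨ +-cong (∑-cong n shift-upper) (trans (∑-comm n n lower) (∑-cong n shift-lower)) ⟩
    ∑∑ n (λ a e → h a (a ℕ.+ e)) + ∑∑ n (λ b e → h (suc b ℕ.+ e) b) ∎
    where
    upper lower : ℕ → ℕ → Carrier
    upper a b = if a ≤ᵇ b then h a b else 0#
    lower a b = if a ≤ᵇ b then 0# else h a b

    upper+lower : ∀ a b → h a b ≈ upper a b + lower a b
    upper+lower a b with a ≤ᵇ b
    ... | true  = sym (+-identityʳ _)
    ... | false = sym (+-identityˡ _)

    upper-≤ : ∀ {a b} → a ≤ b → upper a b ≈ h a b
    upper-≤ {a} {b} a≤b with a ≤ᵇ b | ℕ.≤ᵇ-reflects-≤ a b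
    ... | true  | _       = refl
    ... | false | ofⁿ a≰b = contradiction a≤b a≰b

    upper-> : ∀ {a b} → b < a → upper a b ≈ 0#
    upper-> {a} {b} b<a with a ≤ᵇ b | ℕ.≤ᵇ-reflects-≤ a b
    ... | true  | ofʸ a≤b = contradiction a≤b (ℕ.<⇒≱ b<a)
    ... | false | _       = refl

    lower-≤ : ∀ {a b} → a ≤ b → lower a b ≈ 0#
    lower-≤ {a} {b} a≤b with a ≤ᵇ b | ℕ.≤ᵇ-reflects-≤ a b
    ... | true  | _       = refl
    ... | false | ofⁿ a≰b = contradiction a≤b a≰b

    lower-> : ∀ {a b} → b < a → lower a b ≈ h a b
    lower-> {a} {b} b<a with a ≤ᵇ b | ℕ.≤ᵇ-reflects-≤ a b
    ... | true  | ofʸ a≤b = contradiction a≤b (ℕ.<⇒≱ b<a)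
    ... | false | _       = refl

    upper-high : ∀ a b → n ≤ b → upper a b ≈ 0#
    upper-high a b n≤b with a ≤ᵇ b
    ... | true  = h-tri a b (ℕ.≤-trans n≤b (ℕ.m≤n+m b a))
    ... | false = refl

    lower-high : ∀ b a → n ≤ a → lower a b ≈ 0#
    lower-high b a n≤a with a ≤ᵇ b
    ... | true  = refl
    ... | false = h-tri a b (ℕ.≤-trans n≤a (ℕ.m≤m+n a b))

    shift-upper : ∀ a → ∑ n (upper a) ≈ ∑ n (λ e → h a (a ℕ.+ e))
    shift-upper a = trans (∑-shift a n (λ _ → upper->) (upper-high a)) (∑-cong n λ e → upper-≤ (ℕ.m≤m+n a e))

    shift-lower : ∀ b → ∑ n (λ a → lower a b) ≈ ∑ n (λ e → h (suc b ℕ.+ e) b)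
    shift-lower b = trans (∑-shift (suc b) n (λ { _ (s≤s a≤b) → lower-≤ a≤b }) (lower-high b))
      (∑-cong n λ e → lower-> (ℕ.m≤m+n (suc b) e))

  ∑∑-front : ∀ n {h} → Triangular n h → ∑∑ n h ≈ ∑ n (λ a → h a 0) + ∑∑ n (λ a e → h a (suc e))
  ∑∑-front n {h} h-tri = trans
    (∑-cong n λ a → sym (∑-extend 1 n λ i n≤i → h-tri a i (ℕ.≤-trans n≤i (ℕ.m≤n+m i a))))
    (∑-+ n _ _)

  -- The terms at (a, b) and (b, a) are equal and cancel in characteristic 2.
  ∑∑-symmetric : ∀ n {h} → Triangular n h → (∀ a b → h a b ≈ h b a) → ∑∑ n h ≈ ∑ n (λ a → h a a)
  ∑∑-symmetric n {h} h-tri h-sym = begin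
    ∑∑ n h                                                          ≈⟨ ∑∑-split n h-tri ⟩
    ∑∑ n (λ a e → h a (a ℕ.+ e)) + ∑∑ n (λ b e → h (suc b ℕ.+ e) b)
        ≈⟨ +-congʳ (∑∑-front n λ a e n≤a+e → h-tri a (a ℕ.+ e) (ℕ.≤-trans n≤a+e (ℕ.m≤n+m _ a))) ⟩
    ∑ n (λ a → h a (a ℕ.+ 0)) + ∑∑ n (λ a e → h a (a ℕ.+ suc e)) + ∑∑ n (λ b e → h (suc b ℕ.+ e) b)
      ≈⟨ +-cong (+-cong (∑-cong n λ a → reflexive (≡.cong (h a) (ℕ.+-identityʳ a)))
           (∑∑-cong n λ a e → trans (reflexive (≡.cong (h a) (ℕ.+-suc a e))) (h-sym a _))) refl ⟩
    ∑ n (λ a → h a a) + ∑∑ n (λ b e → h (suc b ℕ.+ e) b) + ∑∑ n (λ b e → h (suc b ℕ.+ e) b)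
      ≈⟨ solve 2 (λ x y → x :+ y :+ y := x) refl _ _ ⟩
    ∑ n (λ a → h a a) ∎

  ∑∑-parity : ∀ n {h} → Triangular n h → ∑∑ n h ≈ ∑∑ n (λ a e → h a (e ℕ.* 2)) + ∑∑ n (λ a e → h a (1 ℕ.+ e ℕ.* 2))
  ∑∑-parity n h-tri = trans
    (∑-cong n λ a → ∑-parity n λ i n≤i → h-tri a i (ℕ.≤-trans n≤i (ℕ.m≤n+m i a)))
    (∑-+ n _ _)

  -- Gauss's triangular number identity in characteristic 2

  module Theta {K : ℕ} {q : ℕ → Carrier} (isPowers : PowersUpTo R K q) where
    open PowersUpTo isPowers

    q-tri : ℕ → Carrier
    q-tri s = q (tri s)

    θ : Carrier
    θ = ∑ K q-tri

    -- With q k = x^k: E n = ∏_{i ≤ n} (1 + xⁱ), D n and C n its odd and even parts in E (2n).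
    E D C : ℕ → Carrier
    E zero    = 1#
    E (suc n) = E n * (1# + q (suc n))
    D zero    = 1#
    D (suc n) = D n * (1# + q (1 ℕ.+ n ℕ.* 2))
    C zero    = 1#
    C (suc n) = C n * (1# + q (suc n ℕ.* 2))

    -- T N m = Σ_{s ≤ m} D s (C m / C s) x^{N s}, in Horner form to avoid the division.
    T : ℕ → ℕ → Carrier
    T N zero    = 1#
    T N (suc m) = (1# + q (suc m ℕ.* 2)) * T N m + D (suc m) * q (suc m ℕ.* N)

    -- After division by `C m`, the s-th terms on the left combine through (1 + x^(N+1)) x^(2s) + (1
    -- + x^N) = (1 + x^(2s)) + x^N (1 + x^(2s+1)). The first part turns `C s` into `C (s - 1)` and
    -- vanishes for s = 0; the second turns `D s` into `D (s + 1)`. Consecutive terms therefore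
    -- share a summand that cancels, and only the last one survives.
    T-shift : ∀ N m → (1# + q (1 ℕ.+ N)) * T (2 ℕ.+ N) m + (1# + q N) * T N m ≈ D (suc m) * q (suc m ℕ.* N)
    T-shift N zero = begin
      (1# + q (1 ℕ.+ N)) * 1# + (1# + q N) * 1# ≈⟨ +-congʳ (*-congʳ (+-congˡ (q-+ 1 N))) ⟩
      (1# + q 1 * q N) * 1# + (1# + q N) * 1#   ≈⟨ solve 2
          (λ x y → (con true :+ x :* y) :* con true :+ (con true :+ y) :* con true := con true :* (con true :+ x) :* y) refl _ _ ⟩
      1# * (1# + q 1) * q N                     ≈⟨ *-congˡ (reflexive (≡.cong q (ℕ.+-identityʳ N))) ⟨
      1# * (1# + q 1) * q (N ℕ.+ 0)             ∎
    T-shift N (suc m) = begin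
      (1# + q (1 ℕ.+ N)) * ((1# + a) * T₂ + P * q (suc m ℕ.* (2 ℕ.+ N))) + (1# + q N) * ((1# + a) * T₀ + P * Y)
        ≈⟨ +-congʳ (*-congˡ (+-congˡ (*-congˡ (trans (reflexive (≡.cong q (ℕ.*-distribˡ-+ (suc m) 2 N))) (q-+ (suc m ℕ.* 2) _))))) ⟩
      (1# + q (1 ℕ.+ N)) * ((1# + a) * T₂ + P * (a * Y)) + (1# + q N) * ((1# + a) * T₀ + P * Y)
        ≈⟨ solve 7 (λ z n a y p t₂ t₀ → (con true :+ z) :* ((con true :+ a) :* t₂ :+ p :* (a :* y)) :+ (con true :+ n) :* ((con true :+ a) :* t₀ :+ p :* y)
             := (con true :+ a) :* ((con true :+ z) :* t₂ :+ (con true :+ n) :* t₀) :+ ((con true :+ z) :* (p :* (a :* y)) :+ (con true :+ n) :* (p :* y))) refl _ _ _ _ _ _ _ ⟩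
      (1# + a) * ((1# + q (1 ℕ.+ N)) * T₂ + (1# + q N) * T₀) + ((1# + q (1 ℕ.+ N)) * (P * (a * Y)) + (1# + q N) * (P * Y))
        ≈⟨ +-cong (*-congˡ (T-shift N m)) (+-congʳ (*-congʳ (+-congˡ (q-+ 1 N)))) ⟩
      (1# + a) * (P * Y) + ((1# + q 1 * q N) * (P * (a * Y)) + (1# + q N) * (P * Y))
        ≈⟨ solve 5 (λ z n a y p → (con true :+ a) :* (p :* y) :+ ((con true :+ z :* n) :* (p :* (a :* y)) :+ (con true :+ n) :* (p :* y)) := p :* (con true :+ z :* a) :* (n :* y)) refl _ _ _ _ _ ⟩
      P * (1# + q 1 * a) * (q N * Y)
        ≈⟨ *-cong (*-congˡ (+-congˡ (q-+ 1 (suc m ℕ.* 2)))) (q-+ N (suc m ℕ.* N)) ⟨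
      P * (1# + q (1 ℕ.+ suc m ℕ.* 2)) * q (N ℕ.+ suc m ℕ.* N) ∎
      where
      a = q (suc m ℕ.* 2)
      P = D (suc m)
      Y = q (suc m ℕ.* N)
      T₂ = T (2 ℕ.+ N) m
      T₀ = T N m

    -- Cf. D. Shanks, Two theorems of Gauss (1958); T-shift is his telescoping sum.
    shanks : ∀ n → T (1 ℕ.+ n ℕ.* 2) n ≈ D n * ∑ (1 ℕ.+ n ℕ.* 2) q-tri
    shanks zero = trans (sym q-0) (trans (sym (+-identityʳ _)) (sym (*-identityˡ _)))
    shanks (suc n) = begin
      (1# + q (1 ℕ.+ N)) * T (2 ℕ.+ N) n + P * q (suc n ℕ.* (2 ℕ.+ N))
        -- The term is inserted twice, at no cost in characteristic 2: one copy completes the left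
        -- side of `T-shift`, the other feeds the induction hypothesis.
        ≈⟨ solve 3 (λ x y z → x :+ z := (x :+ y) :+ y :+ z) refl _ ((1# + q N) * T N n) _ ⟩
      (1# + q (1 ℕ.+ N)) * T (2 ℕ.+ N) n + (1# + q N) * T N n + (1# + q N) * T N n + P * q (suc n ℕ.* (2 ℕ.+ N))
        ≈⟨ +-congʳ (+-cong (T-shift N n) (*-congˡ (shanks n))) ⟩
      P * q (suc n ℕ.* N) + (1# + q N) * (D n * S) + P * q (suc n ℕ.* (2 ℕ.+ N))
        ≈⟨ solve 5 (λ d x s y z → d :* (con true :+ x) :* y :+ (con true :+ x) :* (d :* s) :+ d :* (con true :+ x) :* z
             := d :* (con true :+ x) :* (s :+ y :+ z)) refl _ _ _ _ _ ⟩
      P * (S + q (suc n ℕ.* N) + q (suc n ℕ.* (2 ℕ.+ N)))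
        ≈⟨ *-congˡ (+-cong (+-congˡ (reflexive (≡.cong q (≡.sym (tri-odd n))))) (reflexive (≡.cong q (≡.sym (tri-even n))))) ⟩
      P * (S + q (tri N) + q (tri (1 ℕ.+ N)))
        ≈⟨ *-congˡ (+-congʳ (∑-last N q-tri)) ⟨
      P * (∑ (1 ℕ.+ N) q-tri + q (tri (1 ℕ.+ N)))
        ≈⟨ *-congˡ (∑-last (1 ℕ.+ N) q-tri) ⟨
      P * ∑ (2 ℕ.+ N) q-tri ∎
      where
      N = 1 ℕ.+ n ℕ.* 2
      P = D (suc n)
      S = ∑ N q-tri

    -- Only the term s = 0 is free of a power x^(N s) that vanishes.
    T≈C : ∀ {N} → K ≤ N → ∀ m → T N m ≈ C m
    T≈C         K≤N zero    = refl
    T≈C {N} K≤N (suc m) = begin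
      (1# + q (suc m ℕ.* 2)) * T N m + D (suc m) * q (suc m ℕ.* N)
          ≈⟨ +-cong (*-congˡ (T≈C K≤N m)) (*-congˡ (q-nil (ℕ.≤-trans K≤N (ℕ.m≤m+n N _)))) ⟩
      (1# + q (suc m ℕ.* 2)) * C m + D (suc m) * 0#                ≈⟨ solve 3 (λ x y d → x :* y :+ d :* con false := y :* x) refl _ _ _ ⟩
      C m * (1# + q (suc m ℕ.* 2))                                 ∎

    C≈E² : ∀ n → C n ≈ E n * E n
    C≈E² zero    = sym (*-identityˡ 1#)
    C≈E² (suc n) = begin
      C n * (1# + q (suc n ℕ.* 2))
          ≈⟨ *-cong (C≈E² n) (+-congˡ (trans (reflexive (≡.cong q (≡.sym (n+n≡n*2 (suc n))))) (q-+ (suc n) (suc n)))) ⟩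
      E n * E n * (1# + q (suc n) * q (suc n))
          ≈⟨ solve 2 (λ e x → e :* e :* (con true :+ x :* x) := (e :* (con true :+ x)) :* (e :* (con true :+ x))) refl _ _ ⟩
      E n * (1# + q (suc n)) * (E n * (1# + q (suc n))) ∎

    E≈D*C : ∀ n → E (n ℕ.* 2) ≈ D n * C n
    E≈D*C zero    = sym (*-identityˡ 1#)
    E≈D*C (suc n) = trans (*-congʳ (*-congʳ (E≈D*C n)))
      (solve 4 (λ d c x y → d :* c :* x :* y := (d :* x) :* (c :* y)) refl _ _ _ _)

    -- This is f₁ θ = f₂² with f₂ = f₁², Gauss's identity cleared of its denominator. Both
    -- `E (K ℕ.* 2)` and `E K` stand for f₁ modulo x^K. The former appears because it splits into
    -- the factors `D K` and `C K`: `shanks` absorbs `D K` and returns a second copy of `C K`.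
    E*θ : E (K ℕ.* 2) * θ ≈ E K * E K * (E K * E K)
    E*θ = begin
      E (K ℕ.* 2) * θ           ≈⟨ *-cong (E≈D*C K) θ-extend ⟩
      D K * C K * ∑ N q-tri         ≈⟨ solve 3 (λ d c t → d :* c :* t := c :* (d :* t)) refl _ _ _ ⟩
      C K * (D K * ∑ N q-tri)       ≈⟨ *-congˡ (shanks K) ⟨
      C K * T N K               ≈⟨ *-congˡ (T≈C (ℕ.≤-trans K≤K*2 (ℕ.n≤1+n _)) K) ⟩
      C K * C K                 ≈⟨ *-cong (C≈E² K) (C≈E² K) ⟩
      E K * E K * (E K * E K)   ∎
      where
      N = 1 ℕ.+ K ℕ.* 2
      K≤K*2 : K ≤ K ℕ.* 2
      K≤K*2 = ℕ.m≤m*n K 2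
      θ-extend : θ ≈ ∑ N q-tri
      θ-extend = trans (sym (∑-extend (suc K) K {q-tri} (λ i K≤i → q-nil (ℕ.≤-trans K≤i (n≤tri[n] i)))))
        (reflexive (≡.cong (λ k → ∑ (suc k) q-tri) (n+n≡n*2 K)))

  scale : ∀ {K q} → PowersUpTo R K q → ∀ d .{{_ : ℕ.NonZero d}} → PowersUpTo R K (λ k → q (d ℕ.* k))
  scale {K} {q} isPowers d = record
    { q-0   = trans (reflexive (≡.cong q (ℕ.*-zeroʳ d))) q-0
    ; q-+   = λ m n → trans (reflexive (≡.cong q (ℕ.*-distribˡ-+ d m n))) (q-+ (d ℕ.* m) (d ℕ.* n))
    ; q-nil = λ {k} K≤k → q-nil (ℕ.≤-trans K≤k (ℕ.m≤n*m k d))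
    }
    where open PowersUpTo isPowers

  -- The product of the two theta series

  module ThetaProduct {K : ℕ} {q : ℕ → Carrier} (isPowers : PowersUpTo R K q) where
    open PowersUpTo isPowers
    open Theta isPowers using () renaming (θ to θ₁)
    open Theta (scale isPowers 3) using () renaming (θ to θ₃)

    h : ℕ → ℕ → Carrier
    h s t = q (tri s ℕ.+ 3 ℕ.* tri t)

    θ₁*θ₃≈∑∑h : θ₁ * θ₃ ≈ ∑∑ K h
    θ₁*θ₃≈∑∑h = trans (∑-*ʳ K θ₃ _) (∑-cong K λ s → trans (∑-*ˡ K _ _) (∑-cong K λ t → sym (q-+ (tri s) _)))

    h-high : ∀ {n} s t → n ≤ s ℕ.+ t → K ≤ n → h s t ≈ 0#
    h-high s t n≤s+t K≤n = q-nil (ℕ.≤-trans K≤n (ℕ.≤-trans n≤s+t (ℕ.+-mono-≤ (n≤tri[n] s) (ℕ.≤-trans (n≤tri[n] t) (ℕ.m≤n*m (tri t) 3)))))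

    -- Doubling clears the halves in `tri`, so that equality of exponents becomes a polynomial
    -- identity.
    weight : ∀ s t → (tri s ℕ.+ 3 ℕ.* tri t) ℕ.* 2 ≡ s ℕ.* suc s ℕ.+ 3 ℕ.* (t ℕ.* suc t)
    weight s t = ≡.trans (lemma (tri s) (tri t)) (≡.cong₂ (λ x y → x ℕ.+ 3 ℕ.* y) (tri-*2 s) (tri-*2 t))
      where
      lemma : ∀ x y → (x ℕ.+ 3 ℕ.* y) ℕ.* 2 ≡ x ℕ.* 2 ℕ.+ 3 ℕ.* (y ℕ.* 2)
      lemma = solve-∀

    h-≡ : ∀ s t s′ t′ → s ℕ.* suc s ℕ.+ 3 ℕ.* (t ℕ.* suc t) ≡ s′ ℕ.* suc s′ ℕ.+ 3 ℕ.* (t′ ℕ.* suc t′) → h s t ≈ h s′ t′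
    h-≡ s t s′ t′ eq = reflexive (≡.cong q (ℕ.*-cancelʳ-≡ _ _ 2 (≡.trans (weight s t) (≡.trans eq (≡.sym (weight s′ t′))))))

    -- U₀, U₁ cover s ≤ t and V₀, V₁ cover s > t, by the parity of t - s. The reparametrisations of h below come from
    -- multiplication by a cube root of unity in ℤ[ω]: it pairs U₁ with V₁₀ and the off-diagonal part U₀′ of U₀ with
    -- V₁₁, and acts on V₀ as a symmetry, so only the diagonals of U₀ and V₀ survive.
    U₀ U₀′ U₁ V₀ V₁ V₁₀ V₁₁ : ℕ → ℕ → Carrier
    U₀  s e = h s (s ℕ.+ e ℕ.* 2)
    U₀′ s e = h s (s ℕ.+ suc e ℕ.* 2)
    U₁  s e = h s (s ℕ.+ (1 ℕ.+ e ℕ.* 2))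
    V₀  t e = h (suc t ℕ.+ e ℕ.* 2) t
    V₁  t e = h (suc t ℕ.+ (1 ℕ.+ e ℕ.* 2)) t
    V₁₀ t e = V₁ t (t ℕ.+ e)
    V₁₁ b e = V₁ (suc b ℕ.+ e) b

    -- With X = 2s+1 and Y = 2t+1 the exponent of `h s t` is (X² + 3Y² - 4)/8. For `V₀ t e` one has
    -- X = Y + 2Z with Z = 2e+1, and X² + 3Y² = 4(Y² + YZ + Z²) is symmetric in Y and Z.
    V₀-sym : ∀ t e → V₀ t e ≈ V₀ e t
    V₀-sym t e = h-≡ (suc t ℕ.+ e ℕ.* 2) t (suc e ℕ.+ t ℕ.* 2) e (lemma t e)
      where
      lemma : ∀ t e → (suc t ℕ.+ e ℕ.* 2) ℕ.* suc (suc t ℕ.+ e ℕ.* 2) ℕ.+ 3 ℕ.* (t ℕ.* suc t)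
                    ≡ (suc e ℕ.+ t ℕ.* 2) ℕ.* suc (suc e ℕ.+ t ℕ.* 2) ℕ.+ 3 ℕ.* (e ℕ.* suc e)
      lemma = solve-∀

    -- In the odd coordinates X = 2s+1, Y = 2t+1 this is (X, Y) ↦ ((X + 3Y)/2, (Y - X)/2), which
    -- preserves X² + 3Y². Both images are odd exactly because t - s = (Y - X)/2 is odd.
    U₁≈V₁₀ : ∀ s e → U₁ s e ≈ V₁₀ e s
    U₁≈V₁₀ s e = h-≡ s (s ℕ.+ (1 ℕ.+ e ℕ.* 2)) (suc e ℕ.+ (1 ℕ.+ (e ℕ.+ s) ℕ.* 2)) e (lemma s e)
      where
      lemma : ∀ s e → s ℕ.* suc s ℕ.+ 3 ℕ.* ((s ℕ.+ (1 ℕ.+ e ℕ.* 2)) ℕ.* suc (s ℕ.+ (1 ℕ.+ e ℕ.* 2)))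
                    ≡ (suc e ℕ.+ (1 ℕ.+ (e ℕ.+ s) ℕ.* 2)) ℕ.* suc (suc e ℕ.+ (1 ℕ.+ (e ℕ.+ s) ℕ.* 2)) ℕ.+ 3 ℕ.* (e ℕ.* suc e)
      lemma = solve-∀

    -- The conjugate rotation with a sign dropped, (X, Y) ↦ ((3Y - X)/2, (X + Y)/2), whose images
    -- are odd when t - s is even.
    U₀′≈V₁₁ : ∀ s e → U₀′ s e ≈ V₁₁ e s
    U₀′≈V₁₁ s e = h-≡ s (s ℕ.+ suc e ℕ.* 2) (suc (suc e ℕ.+ s) ℕ.+ (1 ℕ.+ e ℕ.* 2)) (suc e ℕ.+ s) (lemma s e)
      where
      lemma : ∀ s e → s ℕ.* suc s ℕ.+ 3 ℕ.* ((s ℕ.+ suc e ℕ.* 2) ℕ.* suc (s ℕ.+ suc e ℕ.* 2))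
                    ≡ (suc (suc e ℕ.+ s) ℕ.+ (1 ℕ.+ e ℕ.* 2)) ℕ.* suc (suc (suc e ℕ.+ s) ℕ.+ (1 ℕ.+ e ℕ.* 2)) ℕ.+ 3 ℕ.* ((suc e ℕ.+ s) ℕ.* suc (suc e ℕ.+ s))
      lemma = solve-∀

    fourth : ∀ n → q (n ℕ.+ n ℕ.+ (n ℕ.+ n)) ≈ q n * q n * (q n * q n)
    fourth n = trans (q-+ (n ℕ.+ n) (n ℕ.+ n)) (*-cong (q-+ n n) (q-+ n n))

    ∑-fourth : ∀ f → ∑ K (λ s → f s * f s * (f s * f s)) ≈ ∑ K f * ∑ K f * (∑ K f * ∑ K f)
    ∑-fourth f = sym (trans (*-cong (∑-square K f) (∑-square K f)) (∑-square K λ s → f s * f s))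

    diagonal-U₀ : ∑ K (λ s → U₀ s 0) ≈ θ₁ * θ₁ * (θ₁ * θ₁)
    diagonal-U₀ = trans (∑-cong K λ s → trans (reflexive (≡.cong q (eq s))) (fourth (tri s))) (∑-fourth _)
      where
      lemma : ∀ x → x ℕ.+ 3 ℕ.* x ≡ x ℕ.+ x ℕ.+ (x ℕ.+ x)
      lemma = solve-∀
      eq : ∀ s → tri s ℕ.+ 3 ℕ.* tri (s ℕ.+ 0) ≡ tri s ℕ.+ tri s ℕ.+ (tri s ℕ.+ tri s)
      eq s rewrite ℕ.+-identityʳ s = lemma (tri s)

    -- On the diagonal X = 3Y, so the exponent is (12Y² - 4)/8 = 1 + 4 (3 `tri t`). The 1 gives the
    -- factor q, and the 4 is a fourth power taken termwise.
    diagonal-V₀ : ∑ K (λ t → V₀ t t) ≈ q 1 * (θ₃ * θ₃ * (θ₃ * θ₃))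
    diagonal-V₀ = begin
      ∑ K (λ t → V₀ t t)                     ≈⟨ ∑-cong K
          (λ t → trans (reflexive (≡.cong q (eq t))) (trans (q-+ 1 _) (*-congˡ (fourth (3 ℕ.* tri t))))) ⟩
      ∑ K (λ t → q 1 * (g t * g t * (g t * g t))) ≈⟨ ∑-*ˡ K (q 1) _ ⟨
      q 1 * ∑ K (λ t → g t * g t * (g t * g t))   ≈⟨ *-congˡ (∑-fourth g) ⟩
      q 1 * (θ₃ * θ₃ * (θ₃ * θ₃))            ∎
      where
      g : ℕ → Carrier
      g t = q (3 ℕ.* tri t)
      lemma₁ : ∀ t → (suc t ℕ.+ t ℕ.* 2) ℕ.* suc (suc t ℕ.+ t ℕ.* 2) ℕ.+ 3 ℕ.* (t ℕ.* suc t) ≡ 2 ℕ.+ 12 ℕ.* (t ℕ.* suc t)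
      lemma₁ = solve-∀
      lemma₂ : ∀ x → 2 ℕ.+ 12 ℕ.* (x ℕ.* 2) ≡ suc (3 ℕ.* x ℕ.+ 3 ℕ.* x ℕ.+ (3 ℕ.* x ℕ.+ 3 ℕ.* x)) ℕ.* 2
      lemma₂ = solve-∀
      eq : ∀ t → tri (suc t ℕ.+ t ℕ.* 2) ℕ.+ 3 ℕ.* tri t ≡ 1 ℕ.+ (3 ℕ.* tri t ℕ.+ 3 ℕ.* tri t ℕ.+ (3 ℕ.* tri t ℕ.+ 3 ℕ.* tri t))
      eq t = ℕ.*-cancelʳ-≡ _ _ 2 (≡.trans (weight (suc t ℕ.+ t ℕ.* 2) t)
        (≡.trans (lemma₁ t) (≡.trans (≡.cong (λ x → 2 ℕ.+ 12 ℕ.* x) (≡.sym (tri-*2 t))) (lemma₂ (tri t)))))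

    θ₁*θ₃ : θ₁ * θ₃ ≈ θ₁ * θ₁ * (θ₁ * θ₁) + q 1 * (θ₃ * θ₃ * (θ₃ * θ₃))
    θ₁*θ₃ = begin
      θ₁ * θ₃
        ≈⟨ θ₁*θ₃≈∑∑h ⟩
      ∑∑ K h
        ≈⟨ ∑∑-split K (λ s t → h-high s t ℕ.≤-refl) ⟩
      ∑∑ K (λ s e → h s (s ℕ.+ e)) + ∑∑ K (λ t e → h (suc t ℕ.+ e) t)
        ≈⟨ +-cong (∑∑-parity K (λ s e → h-high s (s ℕ.+ e) (ℕ.+-monoʳ-≤ s (ℕ.m≤n+m e s))))
                  (∑∑-parity K (λ t e → h-high (suc t ℕ.+ e) t (ℕ.≤-trans (ℕ.n≤1+n _) (ℕ.m≤m+n (suc t ℕ.+ e) t)))) ⟩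
      ∑∑ K U₀ + ∑∑ K U₁ + (∑∑ K V₀ + ∑∑ K V₁)
        ≈⟨ +-cong (+-cong (∑∑-front K (λ s e → h-high s (s ℕ.+ e ℕ.* 2) (ℕ.+-monoʳ-≤ s (ℕ.≤-trans (ℕ.m≤m*n e 2) (ℕ.m≤n+m _ s)))))
                    (trans (∑∑-cong K U₁≈V₁₀) (∑-comm K K _)))
                  (+-cong (∑∑-symmetric K (λ t e → h-high (suc t ℕ.+ e ℕ.* 2) t (V-bound t e (e ℕ.* 2) (ℕ.m≤m*n e 2))) V₀-sym)
                    (∑∑-split K (λ t e → h-high (suc t ℕ.+ (1 ℕ.+ e ℕ.* 2)) t (V-bound t e _ (ℕ.≤-trans (ℕ.m≤m*n e 2) (ℕ.n≤1+n _)))))) ⟩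
      ∑ K (λ s → U₀ s 0) + ∑∑ K U₀′ + ∑∑ K V₁₀ + (∑ K (λ t → V₀ t t) + (∑∑ K V₁₀ + ∑∑ K V₁₁))
        ≈⟨ +-congʳ (+-congʳ (+-congˡ (trans (∑∑-cong K U₀′≈V₁₁) (∑-comm K K _)))) ⟩
      ∑ K (λ s → U₀ s 0) + ∑∑ K V₁₁ + ∑∑ K V₁₀ + (∑ K (λ t → V₀ t t) + (∑∑ K V₁₀ + ∑∑ K V₁₁))
        ≈⟨ solve 4 (λ x y u v → x :+ u :+ v :+ (y :+ (v :+ u)) := x :+ y) refl _ _ _ _ ⟩
      ∑ K (λ s → U₀ s 0) + ∑ K (λ t → V₀ t t)
        ≈⟨ +-cong diagonal-U₀ diagonal-V₀ ⟩
      θ₁ * θ₁ * (θ₁ * θ₁) + q 1 * (θ₃ * θ₃ * (θ₃ * θ₃)) ∎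
      where
      V-bound : ∀ t e x → e ≤ x → t ℕ.+ e ≤ suc t ℕ.+ x ℕ.+ t
      V-bound t e x e≤x = ℕ.≤-trans (ℕ.+-mono-≤ (ℕ.n≤1+n t) e≤x) (ℕ.m≤m+n (suc t ℕ.+ x) t)

  -- Eighth powers and the dissection of an inverse square

  eighth : Carrier → Carrier
  eighth x = x * x * (x * x) * (x * x * (x * x))

  eighth-* : ∀ x y → eighth (x * y) ≈ eighth x * eighth y
  eighth-* = solve 2 (λ x y → let z = x :* y in
      z :* z :* (z :* z) :* (z :* z :* (z :* z)) := x :* x :* (x :* x) :* (x :* x :* (x :* x)) :* (y :* y :* (y :* y) :* (y :* y :* (y :* y)))) refl

  eighth-cong : ∀ {x y} → x ≈ y → eighth x ≈ eighth y
  eighth-cong x≈y = *-cong x⁴≈y⁴ x⁴≈y⁴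
    where
    x²≈y² = *-cong x≈y x≈y
    x⁴≈y⁴ = *-cong x²≈y² x²≈y²

  eighth-1 : eighth 1# ≈ 1#
  eighth-1 = solve 0 (con true :* con true :* (con true :* con true) :* (con true :* con true :* (con true :* con true)) := con true) refl

  -- Since w t u = 1, w² = w⁸ ((t u)²)³, and squaring the second hypothesis gives (t u)² = t⁸ + z²
  -- u⁸. The binomial coefficients 1, 3, 3, 1 of the cube are all odd, and w⁸ t⁸ u⁸ = 1 simplifies
  -- the two mixed terms.
  inverse-square : ∀ {w t u z} → w * (t * u) ≈ 1# → t * u ≈ t * t * (t * t) + z * (u * u * (u * u)) →
    w * w ≈ eighth (w * (t * t * t)) + z * z * eighth t + z * z * (z * z) * eighth u + z * z * (z * z) * (z * z) * eighth (w * (u * u * u))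
  inverse-square {w} {t} {u} {z} w*tu≈1 tu≈ = begin
    w * w
      ≈⟨ trans (sym (*-identityʳ _)) (*-congˡ (sym cube-1)) ⟩
    w * w * (v * v * (v * v) * (v * v))
      ≈⟨ solve 2 (λ w g → let v = w :* g in w :* w :* (v :* v :* (v :* v) :* (v :* v))
           := (w :* w :* (w :* w) :* (w :* w :* (w :* w))) :* ((g :* g) :* (g :* g) :* (g :* g))) refl _ _ ⟩
    eighth w * (G² * G² * G²)
      ≈⟨ *-congˡ (*-cong (*-cong G²≈ G²≈) G²≈) ⟩
    eighth w * ((eighth t + Z * eighth u) * (eighth t + Z * eighth u) * (eighth t + Z * eighth u))
      ≈⟨ solve 4 (λ W T U Z → W :* ((T :+ Z :* U) :* (T :+ Z :* U) :* (T :+ Z :* U))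
           := W :* (T :* T :* T) :+ Z :* (W :* (T :* U) :* T) :+ Z :* Z :* (W :* (T :* U) :* U) :+ Z :* Z :* Z :* (W :* (U :* U :* U))) refl _ _ _ _ ⟩
    eighth w * (eighth t * eighth t * eighth t) + Z * (WTU * eighth t) + Z * Z * (WTU * eighth u)
        + Z * Z * Z * (eighth w * (eighth u * eighth u * eighth u))
      ≈⟨ +-cong (+-cong (+-cong (sym (w*cube t)) (*-congˡ (cancel _))) (*-congˡ (cancel _))) (*-congˡ (sym (w*cube u))) ⟩
    eighth (w * (t * t * t)) + Z * eighth t + Z * Z * eighth u + Z * Z * Z * eighth (w * (u * u * u)) ∎
    where
    v = w * (t * u)
    Z = z * z
    G² = t * u * (t * u)
    WTU = eighth w * (eighth t * eighth u)

    cube-1 : v * v * (v * v) * (v * v) ≈ 1#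
    cube-1 = trans (*-cong (*-cong v² v²) v²) (trans (*-congʳ (*-identityˡ 1#)) (*-identityˡ 1#))
      where
      v² = trans (*-cong w*tu≈1 w*tu≈1) (*-identityˡ 1#)

    G²≈ : G² ≈ eighth t + Z * eighth u
    G²≈ = trans (*-cong tu≈ tu≈) (solve 3 (λ a b z → (a :+ z :* b) :* (a :+ z :* b) := a :* a :+ z :* z :* (b :* b)) refl _ _ _)

    WTU≈1 : WTU ≈ 1#
    WTU≈1 = begin
      eighth w * (eighth t * eighth u) ≈⟨ *-congˡ (eighth-* t u) ⟨
      eighth w * eighth (t * u)        ≈⟨ eighth-* w (t * u) ⟨
      eighth (w * (t * u))             ≈⟨ eighth-cong w*tu≈1 ⟩
      eighth 1#                        ≈⟨ eighth-1 ⟩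
      1#                               ∎

    cancel : ∀ x → WTU * x ≈ x
    cancel x = trans (*-congʳ WTU≈1) (*-identityˡ x)

    w*cube : ∀ x → eighth (w * (x * x * x)) ≈ eighth w * (eighth x * eighth x * eighth x)
    w*cube x = trans (eighth-* w _) (*-congˡ (trans (eighth-* (x * x) x) (*-congʳ (eighth-* x x))))

-- Parity as a ring homomorphism onto 𝔽₂

odd : ℕ → Bool
odd zero    = false
odd (suc n) = not (odd n)

odd-+ : ∀ m n → odd (m ℕ.+ n) ≡ odd m xor odd n
odd-+ zero    n = ≡.refl
odd-+ (suc m) n = ≡.trans (≡.cong not (odd-+ m n)) (Bool.not-distribˡ-xor (odd m) (odd n))

odd-* : ∀ m n → odd (m ℕ.* n) ≡ odd m ∧ odd n
odd-* zero    n = ≡.refl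
odd-* (suc m) n = ≡.trans (odd-+ n (m ℕ.* n)) (≡.trans (≡.cong (odd n xor_) (odd-* m n)) (lemma (odd m) (odd n)))
  where
  lemma : ∀ a b → b xor (a ∧ b) ≡ not a ∧ b
  lemma false b = Bool.xor-identityʳ b
  lemma true  b = Bool.xor-same b

odd≡false⇒2∣ : ∀ n → odd n ≡ false → 2 ℕ.∣ n
odd≡false⇒2∣ zero          _  = 2 ℕ.∣0
odd≡false⇒2∣ (suc (suc n)) eq = ℕ.∣m∣n⇒∣m+n ℕ.∣-refl (odd≡false⇒2∣ n (≡.trans (≡.sym (Bool.not-involutive (odd n))) eq))

parity : ℤ → Bool
parity i = odd ∣ i ∣

parity-⊖ : ∀ m n → parity (m ⊖ n) ≡ odd m xor odd n
parity-⊖ zero    zero    = ≡.refl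
parity-⊖ zero    (suc n) = ≡.refl
parity-⊖ (suc m) zero    = ≡.sym (Bool.xor-identityʳ _)
parity-⊖ (suc m) (suc n) = ≡.trans (≡.cong parity (ℤ.[1+m]⊖[1+n]≡m⊖n m n))
  (≡.trans (parity-⊖ m n) (≡.sym (Bool.xor-annihilates-not (odd m) (odd n))))

parity-+ : ∀ i j → parity (i ℤ.+ j) ≡ parity i xor parity j
parity-+ (+ m)    (+ n)    = odd-+ m n
parity-+ (+ m)    -[1+ n ] = parity-⊖ m (suc n)
parity-+ -[1+ m ] (+ n)    = ≡.trans (parity-⊖ n (suc m)) (Bool.xor-comm (odd n) (odd (suc m)))
parity-+ -[1+ m ] -[1+ n ] = ≡.trans (Bool.not-involutive _) (≡.trans (odd-+ m n) (≡.sym (Bool.xor-annihilates-not (odd m) (odd n))))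

parity-* : ∀ i j → parity (i ℤ.* j) ≡ parity i ∧ parity j
parity-* i j = ≡.trans (≡.cong odd (ℤ.abs-* i j)) (odd-* ∣ i ∣ ∣ j ∣)

-- Power series over 𝔽₂

Series₂ : Set
Series₂ = ℕ → Bool

open Algebra.Properties.CommutativeSemigroup (CommutativeRing.+-commutativeSemigroup Bool.xor-∧-commutativeRing) using (interchange)

tail : Series₂ → Series₂
tail f n = f (suc n)

infixl 6 _⊕_
infixl 7 _·_

_⊕_ : Series₂ → Series₂ → Series₂
(f ⊕ g) n = f n xor g n

-- The Cauchy product, through f = f(0) + q · `tail f`. In this form multiplication by `q^ (suc k)`
-- at `suc n` computes to multiplication by `q^ k` at `n`.
_·_ : Series₂ → Series₂ → Series₂
(f · g) zero    = f 0 ∧ g 0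
(f · g) (suc n) = (f 0 ∧ g (suc n)) xor (tail f · g) n

0ₛ : Series₂
0ₛ _ = false

q^ : ℕ → Series₂
q^ k n = n ≡ᵇ k

1ₛ : Series₂
1ₛ = q^ 0

·-cong-≤ : ∀ n {f f′ g g′} → (∀ i → i ≤ n → f i ≡ f′ i) → (∀ i → i ≤ n → g i ≡ g′ i) → (f · g) n ≡ (f′ · g′) n
·-cong-≤ zero    f≡ g≡ = ≡.cong₂ _∧_ (f≡ 0 z≤n) (g≡ 0 z≤n)
·-cong-≤ (suc n) f≡ g≡ = ≡.cong₂ _xor_ (≡.cong₂ _∧_ (f≡ 0 z≤n) (g≡ (suc n) ℕ.≤-refl))
  (·-cong-≤ n (λ i i≤n → f≡ (suc i) (s≤s i≤n)) (λ i i≤n → g≡ i (ℕ.m≤n⇒m≤1+n i≤n)))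

·-cong-≗ : ∀ {f f′ g g′} → f ≗ f′ → g ≗ g′ → f · g ≗ f′ · g′
·-cong-≗ f≗ g≗ n = ·-cong-≤ n (λ i _ → f≗ i) (λ i _ → g≗ i)

·-distribʳ : ∀ h f g → (f ⊕ g) · h ≗ f · h ⊕ g · h
·-distribʳ h f g zero    = Bool.∧-distribʳ-xor (h 0) (f 0) (g 0)
·-distribʳ h f g (suc n) = ≡.trans
  (≡.cong₂ _xor_ (Bool.∧-distribʳ-xor (h (suc n)) (f 0) (g 0)) (·-distribʳ h (tail f) (tail g) n))
  (interchange (f 0 ∧ h (suc n)) _ _ _)

·-scaleˡ : ∀ a f g n → ((λ i → a ∧ f i) · g) n ≡ a ∧ (f · g) n
·-scaleˡ a f g zero    = Bool.∧-assoc a (f 0) (g 0)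
·-scaleˡ a f g (suc n) = ≡.trans (≡.cong₂ _xor_ (Bool.∧-assoc a (f 0) _) (·-scaleˡ a (tail f) g n))
  (≡.sym (Bool.∧-distribˡ-xor a _ _))

·-assoc : ∀ f g h → (f · g) · h ≗ f · (g · h)
·-assoc f g h zero    = Bool.∧-assoc (f 0) (g 0) (h 0)
·-assoc f g h (suc n) = begin
  f₀g₀h xor (((λ i → f 0 ∧ tail g i) ⊕ tail f · g) · h) n
      ≡⟨ ≡.cong (f₀g₀h xor_) (·-distribʳ h (λ i → f 0 ∧ tail g i) (tail f · g) n) ⟩
  f₀g₀h xor (((λ i → f 0 ∧ tail g i) · h) n xor ((tail f · g) · h) n)
      ≡⟨ ≡.cong (f₀g₀h xor_) (≡.cong₂ _xor_ (·-scaleˡ (f 0) (tail g) h n) (·-assoc (tail f) g h n)) ⟩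
  f₀g₀h xor ((f 0 ∧ (tail g · h) n) xor (tail f · (g · h)) n)       ≡⟨ Bool.xor-assoc f₀g₀h _ _ ⟨
  (f₀g₀h xor (f 0 ∧ (tail g · h) n)) xor (tail f · (g · h)) n
      ≡⟨ ≡.cong (λ b → (b xor (f 0 ∧ (tail g · h) n)) xor (tail f · (g · h)) n) (Bool.∧-assoc (f 0) (g 0) _) ⟩
  ((f 0 ∧ (g 0 ∧ h (suc n))) xor (f 0 ∧ (tail g · h) n)) xor (tail f · (g · h)) n
      ≡⟨ ≡.cong (_xor (tail f · (g · h)) n) (Bool.∧-distribˡ-xor (f 0) _ _) ⟨
  (f 0 ∧ (g · h) (suc n)) xor (tail f · (g · h)) n                  ∎
  where
  open ≡.≡-Reasoning
  f₀g₀h = (f 0 ∧ g 0) ∧ h (suc n)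

-- The mirror image of the defining recursion, peeling the second factor; commutativity and the
-- squaring rule rest on it.
·-sucʳ : ∀ f g n → (f · g) (suc n) ≡ (f (suc n) ∧ g 0) xor (f · tail g) n
·-sucʳ f g zero    = Bool.xor-comm (f 0 ∧ g 1) _
·-sucʳ f g (suc n) = begin
  (f 0 ∧ g (2 ℕ.+ n)) xor (tail f · g) (suc n)
      ≡⟨ ≡.cong ((f 0 ∧ g (2 ℕ.+ n)) xor_) (·-sucʳ (tail f) g n) ⟩
  (f 0 ∧ g (2 ℕ.+ n)) xor ((f (2 ℕ.+ n) ∧ g 0) xor (tail f · tail g) n)               ≡⟨ Bool.xor-assoc (f 0 ∧ g (2 ℕ.+ n)) _ _ ⟨
  ((f 0 ∧ g (2 ℕ.+ n)) xor (f (2 ℕ.+ n) ∧ g 0)) xor (tail f · tail g) n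
      ≡⟨ ≡.cong (_xor (tail f · tail g) n) (Bool.xor-comm (f 0 ∧ g (2 ℕ.+ n)) _) ⟩
  ((f (2 ℕ.+ n) ∧ g 0) xor (f 0 ∧ g (2 ℕ.+ n))) xor (tail f · tail g) n               ≡⟨ Bool.xor-assoc (f (2 ℕ.+ n) ∧ g 0) _ _ ⟩
  (f (2 ℕ.+ n) ∧ g 0) xor (f · tail g) (suc n)                                        ∎
  where open ≡.≡-Reasoning

·-comm : ∀ f g → f · g ≗ g · f
·-comm f g zero    = Bool.∧-comm (f 0) (g 0)
·-comm f g (suc n) = ≡.trans (≡.cong₂ _xor_ (Bool.∧-comm (f 0) _) (·-comm (tail f) g n)) (≡.sym (·-sucʳ g f n))

·-zeroˡ : ∀ f → 0ₛ · f ≗ 0ₛ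
·-zeroˡ f zero    = ≡.refl
·-zeroˡ f (suc n) = ·-zeroˡ f n

·-identityˡ : ∀ f → 1ₛ · f ≗ f
·-identityˡ f zero    = ≡.refl
·-identityˡ f (suc n) = ≡.trans (≡.cong (f (suc n) xor_) (·-zeroˡ f n)) (Bool.xor-identityʳ _)

q^-· : ∀ k f n → (q^ k · f) (k ℕ.+ n) ≡ f n
q^-· zero    f n = ·-identityˡ f n
q^-· (suc k) f n = q^-· k f n

q^-·-< : ∀ {k n} f → n < k → (q^ k · f) n ≡ false
q^-·-< {suc k} {zero}  f _         = ≡.refl
q^-·-< {suc k} {suc n} f (s≤s n<k) = q^-·-< f n<k

q^-+ : ∀ m n → q^ (m ℕ.+ n) ≗ q^ m · q^ n
q^-+ zero    n i       = ≡.sym (·-identityˡ (q^ n) i)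
q^-+ (suc m) n zero    = ≡.refl
q^-+ (suc m) n (suc i) = q^-+ m n i

-- The two cross terms f(0) f(n+2) cancel, so f² = f(0)² + q² (`tail f`)². Iterating this gives
-- f(q)² = f(q²) coefficientwise.
square-suc² : ∀ f n → (f · f) (2 ℕ.+ n) ≡ (tail f · tail f) n
square-suc² f n = begin
  (f 0 ∧ f (2 ℕ.+ n)) xor (tail f · f) (suc n)                          ≡⟨ ≡.cong ((f 0 ∧ f (2 ℕ.+ n)) xor_) (·-sucʳ (tail f) f n) ⟩
  (f 0 ∧ f (2 ℕ.+ n)) xor ((f (2 ℕ.+ n) ∧ f 0) xor (tail f · tail f) n)
      ≡⟨ ≡.cong (λ b → (f 0 ∧ f (2 ℕ.+ n)) xor (b xor (tail f · tail f) n)) (Bool.∧-comm (f (2 ℕ.+ n)) (f 0)) ⟩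
  (f 0 ∧ f (2 ℕ.+ n)) xor ((f 0 ∧ f (2 ℕ.+ n)) xor (tail f · tail f) n) ≡⟨ Bool.xor-assoc (f 0 ∧ f (2 ℕ.+ n)) _ _ ⟨
  ((f 0 ∧ f (2 ℕ.+ n)) xor (f 0 ∧ f (2 ℕ.+ n))) xor (tail f · tail f) n
      ≡⟨ ≡.cong (_xor (tail f · tail f) n) (Bool.xor-same (f 0 ∧ f (2 ℕ.+ n))) ⟩
  (tail f · tail f) n                                                   ∎
  where open ≡.≡-Reasoning

square-even : ∀ f n → (f · f) (n ℕ.* 2) ≡ f n
square-even f zero    = Bool.∧-idem (f 0)
square-even f (suc n) = ≡.trans (square-suc² f (n ℕ.* 2)) (square-even (tail f) n)

square-odd : ∀ f n → (f · f) (1 ℕ.+ n ℕ.* 2) ≡ false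
square-odd f zero    = ≡.trans (≡.cong ((f 0 ∧ f 1) xor_) (Bool.∧-comm (f 1) (f 0))) (Bool.xor-same (f 0 ∧ f 1))
square-odd f (suc n) = ≡.trans (square-suc² f (1 ℕ.+ n ℕ.* 2)) (square-odd (tail f) n)

-- The ring 𝔽₂[q]/(q^K)

infix 4 _≈[_]_

record _≈[_]_ (f : Series₂) (K : ℕ) (g : Series₂) : Set where
  constructor agree
  field
    coefficient : ∀ {n} → n < K → f n ≡ g n

open _≈[_]_

≗⇒≈ : ∀ {K f g} → f ≗ g → f ≈[ K ] g
≗⇒≈ f≗g = agree λ {n} _ → f≗g n

·-cong : ∀ {K f f′ g g′} → f ≈[ K ] f′ → g ≈[ K ] g′ → f · g ≈[ K ] f′ · g′
·-cong f≈ g≈ = agree λ {n} n<K → ·-cong-≤ n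
  (λ i i≤n → coefficient f≈ (ℕ.≤-<-trans i≤n n<K)) (λ i i≤n → coefficient g≈ (ℕ.≤-<-trans i≤n n<K))

truncated : ℕ → CommutativeRing 0ℓ 0ℓ
truncated K = record
  { Carrier = Series₂
  ; _≈_ = _≈[ K ]_
  ; _+_ = _⊕_
  ; _*_ = _·_
  ; -_  = λ f → f
  ; 0#  = 0ₛ
  ; 1#  = 1ₛ
  ; isCommutativeRing = record
    { isRing = record
      { +-isAbelianGroup = record
        { isGroup = record
          { isMonoid = record
            { isSemigroup = record
              { isMagma = record
                { isEquivalence = record
                  { refl  = agree λ _ → ≡.refl
                  ; sym   = λ f≈g → agree λ n<K → ≡.sym (coefficient f≈g n<K)
                  ; trans = λ f≈g g≈h → agree λ n<K → ≡.trans (coefficient f≈g n<K) (coefficient g≈h n<K)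
                  }
                ; ∙-cong = λ f≈ g≈ → agree λ n<K → ≡.cong₂ _xor_ (coefficient f≈ n<K) (coefficient g≈ n<K)
                }
              ; assoc = λ f g h → ≗⇒≈ λ n → Bool.xor-assoc (f n) (g n) (h n)
              }
            ; identity = (λ f → ≗⇒≈ λ _ → ≡.refl) , (λ f → ≗⇒≈ λ n → Bool.xor-identityʳ (f n))
            }
          ; inverse = (λ f → ≗⇒≈ λ n → Bool.xor-same (f n)) , (λ f → ≗⇒≈ λ n → Bool.xor-same (f n))
          ; ⁻¹-cong = λ f≈g → f≈g
          }
        ; comm = λ f g → ≗⇒≈ λ n → Bool.xor-comm (f n) (g n)
        }
      ; *-cong     = ·-cong
      ; *-assoc    = λ f g h → ≗⇒≈ (·-assoc f g h)
      ; *-identity = (λ f → ≗⇒≈ (·-identityˡ f)) , (λ f → ≗⇒≈ λ n → ≡.trans (·-comm f 1ₛ n) (·-identityˡ f n))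
      ; distrib    = (λ h f g → ≗⇒≈ λ n → ≡.trans (·-comm h (f ⊕ g) n)
          (≡.trans (·-distribʳ h f g n) (≡.cong₂ _xor_ (·-comm f h n) (·-comm g h n))))
                   , (λ h f g → ≗⇒≈ (·-distribʳ h f g))
      }
    ; *-comm = λ f g → ≗⇒≈ (·-comm f g)
    }
  }

truncated-char2 : ∀ K → CharacteristicTwo (truncated K)
truncated-char2 K = ≗⇒≈ λ n → Bool.xor-same (1ₛ n)

≡ᵇ-< : ∀ {m n} → m < n → (m ≡ᵇ n) ≡ false
≡ᵇ-< {zero}  {suc n} _         = ≡.refl
≡ᵇ-< {suc m} {suc n} (s≤s m<n) = ≡ᵇ-< m<n

q^-≈0 : ∀ {K k} → K ≤ k → q^ k ≈[ K ] 0ₛ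
q^-≈0 K≤k = agree λ n<K → ≡ᵇ-< (ℕ.<-≤-trans n<K K≤k)

q^-powers : ∀ K → PowersUpTo (truncated K) K q^
q^-powers K = record
  { q-0   = ≗⇒≈ λ _ → ≡.refl
  ; q-+   = λ m n → ≗⇒≈ (q^-+ m n)
  ; q-nil = q^-≈0
  }

-- Reduction of integer series modulo 2

mod₂ : Series → Series₂
mod₂ f n = parity (f n)

sumUpTo-suc : ∀ n f → sumUpTo (suc n) f ≡ f 0 ℤ.+ sumUpTo n (λ i → f (suc i))
sumUpTo-suc zero    f = ≡.refl
sumUpTo-suc (suc n) f = ≡.trans (≡.cong (ℤ._+ f (2 ℕ.+ n)) (sumUpTo-suc n f)) (ℤ.+-assoc (f 0) _ _)

mod₂-⊛ : ∀ f g → mod₂ (f ⊛ g) ≗ mod₂ f · mod₂ g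
mod₂-⊛ f g zero    = parity-* (f 0) (g 0)
mod₂-⊛ f g (suc n) = ≡.trans (≡.cong parity (sumUpTo-suc n λ i → f i ℤ.* g (suc n ∸ i)))
  (≡.trans (parity-+ (f 0 ℤ.* g (suc n)) _)
    (≡.cong₂ _xor_ (parity-* (f 0) (g (suc n))) (mod₂-⊛ (λ i → f (suc i)) g n)))

mod₂-oneS : mod₂ oneS ≗ 1ₛ
mod₂-oneS zero    = ≡.refl
mod₂-oneS (suc n) = ≡.refl

mod₂-oneMinusQ^ : ∀ k .{{_ : ℕ.NonZero k}} → mod₂ (oneMinusQ^ k) ≗ 1ₛ ⊕ q^ k
mod₂-oneMinusQ^ (suc k) zero    = ≡.refl
mod₂-oneMinusQ^ (suc k) (suc n) with n ≡ᵇ k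
... | true  = ≡.refl
... | false = ≡.refl

mod₂-geomQ^ : ∀ k n → mod₂ (geomQ^ k) n ≡ does (k ∣? n)
mod₂-geomQ^ k n with does (k ∣? n)
... | true  = ≡.refl
... | false = ≡.refl

geomQ^-low : ∀ k n → n < k → mod₂ (geomQ^ k) n ≡ 1ₛ n
geomQ^-low k zero    _   = ≡.trans (mod₂-geomQ^ k 0) (dec-true (k ∣? 0) (k ℕ.∣0))
geomQ^-low k (suc n) n<k = ≡.trans (mod₂-geomQ^ k (suc n)) (dec-false (k ∣? suc n) (ℕ.>⇒∤ n<k))

-- Multiplication by 1 + q^k adds to each coefficient the one k places earlier. From k on the two
-- agree by periodicity and cancel; below k only the constant term is nonzero.
geomQ^-inverse : ∀ k .{{_ : ℕ.NonZero k}} → mod₂ (oneMinusQ^ k) · mod₂ (geomQ^ k) ≗ 1ₛ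
geomQ^-inverse k@(suc k-1) n = ≡.trans (·-cong-≗ (mod₂-oneMinusQ^ k) (λ _ → ≡.refl) n)
  (≡.trans (·-distribʳ G 1ₛ (q^ k) n) (≡.trans (≡.cong (_xor (q^ k · G) n) (·-identityˡ G n)) (go (ℕ.<-≤-connex n k))))
  where
  G = mod₂ (geomQ^ k)
  periodic : ∀ j → G (k ℕ.+ j) ≡ G j
  periodic j = ≡.trans (mod₂-geomQ^ k (k ℕ.+ j)) (≡.trans
    (does-⇔ (mk⇔ (λ k∣k+j → ℕ.∣m+n∣m⇒∣n k∣k+j ℕ.∣-refl) (ℕ.∣m∣n⇒∣m+n ℕ.∣-refl)) (k ∣? (k ℕ.+ j)) (k ∣? j))
    (≡.sym (mod₂-geomQ^ k j)))
  go : n < k ⊎ k ≤ n → G n xor (q^ k · G) n ≡ 1ₛ n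
  go (inj₁ n<k) = ≡.trans (≡.cong₂ _xor_ (geomQ^-low k n n<k) (q^-·-< G n<k)) (Bool.xor-identityʳ _)
  go (inj₂ k≤n) with ℕ.m≤n⇒∃[o]m+o≡n k≤n
  ... | j , ≡.refl = ≡.trans (≡.cong₂ _xor_ (periodic j) (q^-· k G j)) (Bool.xor-same (G j))

-- Eta quotients modulo 2

-- `euler` and `eulerInv` read the m-th coefficient off the m-th partial product. As the factor
-- numbered N + 1 changes no coefficient up to N, one partial product with N ≥ K serves for all
-- coefficients below K.
diagonal-≈ : (P : ℕ → Series₂) → (∀ N → P (suc N) ≈[ suc N ] P N) → ∀ {K N} → K ≤ N → (λ m → P m m) ≈[ K ] P N
diagonal-≈ P step {K} {N} K≤N = agree λ {m} m<K → stable m (ℕ.≤⇒≤′ (ℕ.<⇒≤ (ℕ.<-≤-trans m<K K≤N)))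
  where
  stable : ∀ m {N} → m ℕ.≤′ N → P m m ≡ P N m
  stable m ℕ.≤′-refl         = ≡.refl
  stable m (ℕ.≤′-step m≤′N) = ≡.trans (stable m m≤′N) (≡.sym (coefficient (step _) (s≤s (ℕ.≤′⇒≤ m≤′N))))

module EtaMod2 (K : ℕ) where
  open CommutativeRing (truncated K) public
  open CharTwo (truncated K) (truncated-char2 K) public
  open Relation.Binary.Reasoning.Setoid setoid

  eulerTrunc-suc : ∀ d .{{_ : ℕ.NonZero d}} N → mod₂ (eulerTrunc d (suc N)) ≗ mod₂ (eulerTrunc d N) · (1ₛ ⊕ q^ (d ℕ.* suc N))
  eulerTrunc-suc d N n = ≡.trans (mod₂-⊛ (eulerTrunc d N) (oneMinusQ^ (d ℕ.* suc N)) n)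
    (·-cong-≗ (λ _ → ≡.refl) (mod₂-oneMinusQ^ (d ℕ.* suc N) {{ℕ.m*n≢0 d (suc N)}}) n)

  euler≈eulerTrunc : ∀ d .{{_ : ℕ.NonZero d}} {N} → K ≤ N → mod₂ (euler d) ≈ mod₂ (eulerTrunc d N)
  euler≈eulerTrunc d = diagonal-≈ (λ N → mod₂ (eulerTrunc d N)) step
    where
    step : ∀ N → mod₂ (eulerTrunc d (suc N)) ≈[ suc N ] mod₂ (eulerTrunc d N)
    step N = R.trans (≗⇒≈ (eulerTrunc-suc d N)) (R.trans
        (·-cong R.refl (R.trans (R.+-congˡ {1ₛ} (q^-≈0 (ℕ.m≤n*m (suc N) d))) (R.+-identityʳ 1ₛ)))
        (R.*-identityʳ _))
      where module R = CommutativeRing (truncated (suc N))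

  eulerInv≈eulerInvTrunc : ∀ d .{{_ : ℕ.NonZero d}} {N} → K ≤ N → mod₂ (eulerInv d) ≈ mod₂ (eulerInvTrunc d N)
  eulerInv≈eulerInvTrunc d = diagonal-≈ (λ N → mod₂ (eulerInvTrunc d N)) step
    where
    step : ∀ N → mod₂ (eulerInvTrunc d (suc N)) ≈[ suc N ] mod₂ (eulerInvTrunc d N)
    step N = R.trans (≗⇒≈ (mod₂-⊛ (eulerInvTrunc d N) (geomQ^ (d ℕ.* suc N)))) (R.trans
        (·-cong R.refl (agree λ {n} n<1+N → geomQ^-low _ n (ℕ.<-≤-trans n<1+N (ℕ.m≤n*m (suc N) d))))
        (R.*-identityʳ _))
      where module R = CommutativeRing (truncated (suc N))

  eulerTrunc-inverse : ∀ d .{{_ : ℕ.NonZero d}} N → mod₂ (eulerTrunc d N) · mod₂ (eulerInvTrunc d N) ≈ 1ₛ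
  eulerTrunc-inverse d zero    = trans (*-cong (≗⇒≈ mod₂-oneS) (≗⇒≈ mod₂-oneS)) (*-identityˡ 1ₛ)
  eulerTrunc-inverse d (suc N) = begin
    mod₂ (eulerTrunc d (suc N)) · mod₂ (eulerInvTrunc d (suc N))
      ≈⟨ *-cong (≗⇒≈ (mod₂-⊛ (eulerTrunc d N) (oneMinusQ^ k))) (≗⇒≈ (mod₂-⊛ (eulerInvTrunc d N) (geomQ^ k))) ⟩
    mod₂ (eulerTrunc d N) · mod₂ (oneMinusQ^ k) · (mod₂ (eulerInvTrunc d N) · mod₂ (geomQ^ k))
      ≈⟨ solve 4 (λ e u i v → e :* u :* (i :* v) := e :* i :* (u :* v))
           refl (mod₂ (eulerTrunc d N)) (mod₂ (oneMinusQ^ k)) (mod₂ (eulerInvTrunc d N)) (mod₂ (geomQ^ k)) ⟩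
    mod₂ (eulerTrunc d N) · mod₂ (eulerInvTrunc d N) · (mod₂ (oneMinusQ^ k) · mod₂ (geomQ^ k))
      ≈⟨ *-cong (eulerTrunc-inverse d N) (≗⇒≈ (geomQ^-inverse k {{ℕ.m*n≢0 d (suc N)}})) ⟩
    1ₛ · 1ₛ
      ≈⟨ *-identityˡ 1ₛ ⟩
    1ₛ ∎
    where
    k = d ℕ.* suc N

  euler-inverse : ∀ d .{{_ : ℕ.NonZero d}} → mod₂ (euler d) · mod₂ (eulerInv d) ≈ 1ₛ
  euler-inverse d = trans (*-cong (euler≈eulerTrunc d ℕ.≤-refl) (eulerInv≈eulerInvTrunc d ℕ.≤-refl)) (eulerTrunc-inverse d K)

  euler-double : ∀ d .{{_ : ℕ.NonZero d}} .{{_ : ℕ.NonZero (d ℕ.* 2)}} → mod₂ (euler (d ℕ.* 2)) ≈ mod₂ (euler d) · mod₂ (euler d)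
  euler-double d = begin
    mod₂ (euler (d ℕ.* 2))                           ≈⟨ euler≈eulerTrunc (d ℕ.* 2) ℕ.≤-refl ⟩
    mod₂ (eulerTrunc (d ℕ.* 2) K)                    ≈⟨ double K ⟩
    mod₂ (eulerTrunc d K) · mod₂ (eulerTrunc d K)    ≈⟨ *-cong (euler≈eulerTrunc d ℕ.≤-refl) (euler≈eulerTrunc d ℕ.≤-refl) ⟨
    mod₂ (euler d) · mod₂ (euler d)                  ∎
    where
    exponent : ∀ n → d ℕ.* 2 ℕ.* n ≡ d ℕ.* n ℕ.+ d ℕ.* n
    exponent n = ≡.trans (≡.cong (ℕ._* n) (≡.trans (ℕ.*-comm d 2) (≡.cong (d ℕ.+_) (ℕ.+-identityʳ d)))) (ℕ.*-distribʳ-+ n d d)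

    double : ∀ N → mod₂ (eulerTrunc (d ℕ.* 2) N) ≈ mod₂ (eulerTrunc d N) · mod₂ (eulerTrunc d N)
    double zero    = trans (≗⇒≈ mod₂-oneS) (sym (trans (*-cong (≗⇒≈ mod₂-oneS) (≗⇒≈ mod₂-oneS)) (*-identityˡ 1ₛ)))
    double (suc N) = begin
      mod₂ (eulerTrunc (d ℕ.* 2) (suc N))
        ≈⟨ ≗⇒≈ (eulerTrunc-suc (d ℕ.* 2) N) ⟩
      mod₂ (eulerTrunc (d ℕ.* 2) N) · (1ₛ ⊕ q^ (d ℕ.* 2 ℕ.* suc N))
        ≈⟨ *-cong (double N) (+-congˡ {1ₛ} (trans (reflexive (≡.cong q^ (exponent (suc N)))) (≗⇒≈ (q^-+ k k)))) ⟩
      mod₂ (eulerTrunc d N) · mod₂ (eulerTrunc d N) · (1ₛ ⊕ q^ k · q^ k)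
        ≈⟨ solve 2 (λ e x → e :* e :* (con true :+ x :* x) := (e :* (con true :+ x)) :* (e :* (con true :+ x)))
             refl (mod₂ (eulerTrunc d N)) (q^ k) ⟩
      mod₂ (eulerTrunc d N) · (1ₛ ⊕ q^ k) · (mod₂ (eulerTrunc d N) · (1ₛ ⊕ q^ k))
        ≈⟨ *-cong (≗⇒≈ (eulerTrunc-suc d N)) (≗⇒≈ (eulerTrunc-suc d N)) ⟨
      mod₂ (eulerTrunc d (suc N)) · mod₂ (eulerTrunc d (suc N)) ∎
      where
      k = d ℕ.* suc N

  module _ {q : ℕ → Series₂} (isPowers : PowersUpTo (truncated K) K q)
           (d : ℕ) .{{_ : ℕ.NonZero d}} (q≡ : ∀ k → q k ≡ q^ (d ℕ.* k)) where
    open Theta isPowers using (θ; E; E*θ)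

    E≈eulerTrunc : ∀ N → E N ≈ mod₂ (eulerTrunc d N)
    E≈eulerTrunc zero    = sym (≗⇒≈ mod₂-oneS)
    E≈eulerTrunc (suc N) = trans (*-cong (E≈eulerTrunc N) (+-congˡ {1ₛ} (reflexive (q≡ (suc N))))) (sym (≗⇒≈ (eulerTrunc-suc d N)))

    -- `E*θ` reads f θ = f⁴ modulo q^K, and f is invertible with inverse `eulerInv d`.
    θ≈euler³ : θ ≈ mod₂ (euler d) · mod₂ (euler d) · mod₂ (euler d)
    θ≈euler³ = begin
      θ                          ≈⟨ *-identityˡ θ ⟨
      1ₛ · θ                     ≈⟨ *-congʳ (euler-inverse d) ⟨
      e · i · θ                  ≈⟨ solve 3 (λ e i t → e :* i :* t := i :* (e :* t)) refl e i θ ⟩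
      i · (e · θ)                ≈⟨ *-congˡ (*-congʳ (trans (euler≈eulerTrunc d (ℕ.m≤m*n K 2)) (sym (E≈eulerTrunc (K ℕ.* 2))))) ⟩
      i · (E (K ℕ.* 2) · θ)      ≈⟨ *-congˡ E*θ ⟩
      i · (E K · E K · (E K · E K)) ≈⟨ *-congˡ (*-cong (*-cong EK≈e EK≈e) (*-cong EK≈e EK≈e)) ⟩
      i · (e · e · (e · e))      ≈⟨ solve 2 (λ e i → i :* (e :* e :* (e :* e)) := e :* i :* (e :* e :* e)) refl e i ⟩
      e · i · (e · e · e)        ≈⟨ *-congʳ (euler-inverse d) ⟩
      1ₛ · (e · e · e)           ≈⟨ *-identityˡ _ ⟩
      e · e · e                  ∎
      where
      e = mod₂ (euler d)
      i = mod₂ (eulerInv d)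
      EK≈e : E K ≈ e
      EK≈e = trans (E≈eulerTrunc K) (sym (euler≈eulerTrunc d ℕ.≤-refl))

  -- The eta quotient and its dissection modulo 8

  open Theta (q^-powers K) public using () renaming (θ to θ₁)
  open Theta (scale (q^-powers K) 3) public using () renaming (θ to θ₃)

  e₁ e₃ i₂ i₆ x : Series₂
  e₁ = mod₂ (euler 1)
  e₃ = mod₂ (euler 3)
  i₂ = mod₂ (eulerInv 2)
  i₆ = mod₂ (eulerInv 6)
  x  = e₁ · e₃ · i₂ · i₆

  x≈ : mod₂ (euler 1 ⊛ euler 3 ⊛ eulerInv 2 ⊛ eulerInv 6) ≈ x
  x≈ = trans (≗⇒≈ (mod₂-⊛ (euler 1 ⊛ euler 3 ⊛ eulerInv 2) (eulerInv 6)))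
    (*-congʳ (trans (≗⇒≈ (mod₂-⊛ (euler 1 ⊛ euler 3) (eulerInv 2)))
      (*-congʳ (≗⇒≈ (mod₂-⊛ (euler 1) (euler 3))))))

  mod₂-^ˢ : ∀ f {g} → mod₂ f ≈ g → ∀ r {h} → mod₂ (f ^ˢ r) ≈ h → mod₂ (f ^ˢ suc r) ≈ g · h
  mod₂-^ˢ f f≈ r fʳ≈ = trans (≗⇒≈ (mod₂-⊛ f (f ^ˢ r))) (*-cong f≈ fʳ≈)

  etaQuotA≈ : mod₂ etaQuotA ≈ x · x · x · (x · x · x)
  etaQuotA≈ = trans
    (x^ 5 (x^ 4 (x^ 3 (x^ 2 (x^ 1 (x^ 0 (≗⇒≈ mod₂-oneS)))))))
    (solve 1 (λ x → x :* (x :* (x :* (x :* (x :* (x :* con true))))) := x :* x :* x :* (x :* x :* x)) refl x)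
    where
    x^ = mod₂-^ˢ (euler 1 ⊛ euler 3 ⊛ eulerInv 2 ⊛ eulerInv 6) x≈

  -- By f₂ = f₁² and f₆ = f₃², the quotient f₁f₃/(f₂f₆) is 1/(f₁f₃) modulo 2.
  x*e₁e₃≈1 : x · (e₁ · e₃) ≈ 1ₛ
  x*e₁e₃≈1 = begin
    e₁ · e₃ · i₂ · i₆ · (e₁ · e₃)
      ≈⟨ solve 4 (λ a b c d → a :* b :* c :* d :* (a :* b) := (a :* a :* c) :* (b :* b :* d)) refl e₁ e₃ i₂ i₆ ⟩
    (e₁ · e₁ · i₂) · (e₃ · e₃ · i₆)
      ≈⟨ *-cong (*-congʳ (euler-double 1)) (*-congʳ (euler-double 3)) ⟨
    (mod₂ (euler 2) · i₂) · (mod₂ (euler 6) · i₆)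
      ≈⟨ *-cong (euler-inverse 2) (euler-inverse 6) ⟩
    1ₛ · 1ₛ
      ≈⟨ *-identityˡ 1ₛ ⟩
    1ₛ ∎

  -- This makes x³ the w of `inverse-square`, whose square x⁶ is `etaQuotA` modulo 2.
  x³*θ₁θ₃≈1 : x · x · x · (θ₁ · θ₃) ≈ 1ₛ
  x³*θ₁θ₃≈1 = begin
    x · x · x · (θ₁ · θ₃)
      ≈⟨ *-congˡ (*-cong (θ≈euler³ (q^-powers K) 1 (λ k → ≡.cong q^ (≡.sym (ℕ.*-identityˡ k))))
           (θ≈euler³ (scale (q^-powers K) 3) 3 (λ _ → ≡.refl))) ⟩
    x · x · x · (e₁ · e₁ · e₁ · (e₃ · e₃ · e₃))
      ≈⟨ solve 3 (λ x a b → x :* x :* x :* (a :* a :* a :* (b :* b :* b))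
           := x :* (a :* b) :* (x :* (a :* b)) :* (x :* (a :* b))) refl x e₁ e₃ ⟩
    y · y · y
      ≈⟨ *-cong (trans (*-cong x*e₁e₃≈1 x*e₁e₃≈1) (*-identityˡ 1ₛ)) x*e₁e₃≈1 ⟩
    1ₛ · 1ₛ
      ≈⟨ *-identityˡ 1ₛ ⟩
    1ₛ ∎
    where
    y = x · (e₁ · e₃)

  etaQuotA-dissection : mod₂ etaQuotA ≈ eighth (x · x · x · (θ₁ · θ₁ · θ₁)) ⊕ q^ 2 · eighth θ₁ ⊕ q^ 4 · eighth θ₃
      ⊕ q^ 6 · eighth (x · x · x · (θ₃ · θ₃ · θ₃))
  etaQuotA-dissection = begin
    mod₂ etaQuotA
      ≈⟨ etaQuotA≈ ⟩
    x · x · x · (x · x · x)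
      ≈⟨ inverse-square {x · x · x} {θ₁} {θ₃} {q^ 1} x³*θ₁θ₃≈1 (ThetaProduct.θ₁*θ₃ (q^-powers K)) ⟩
    eighth (x · x · x · (θ₁ · θ₁ · θ₁)) ⊕ Z · eighth θ₁ ⊕ Z · Z · eighth θ₃ ⊕ Z · Z · Z · eighth (x · x · x · (θ₃ · θ₃ · θ₃))
      ≈⟨ +-cong (+-cong (+-congˡ {eighth (x · x · x · (θ₁ · θ₁ · θ₁))} (*-congʳ {eighth θ₁} Z≈)) (*-congʳ {eighth θ₃} Z²≈))
           (*-congʳ {eighth (x · x · x · (θ₃ · θ₃ · θ₃))} Z³≈) ⟩
    eighth (x · x · x · (θ₁ · θ₁ · θ₁)) ⊕ q^ 2 · eighth θ₁ ⊕ q^ 4 · eighth θ₃ ⊕ q^ 6 · eighth (x · x · x · (θ₃ · θ₃ · θ₃)) ∎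
    where
    Z = q^ 1 · q^ 1
    Z≈ : Z ≈ q^ 2
    Z≈ = sym (≗⇒≈ (q^-+ 1 1))
    Z²≈ : Z · Z ≈ q^ 4
    Z²≈ = trans (*-cong Z≈ Z≈) (sym (≗⇒≈ (q^-+ 2 2)))
    Z³≈ : Z · Z · Z ≈ q^ 6
    Z³≈ = trans (*-cong Z²≈ Z≈) (sym (≗⇒≈ (q^-+ 4 2)))

  ∑-true : ∀ n f t → ∑ n f t ≡ true → ∃ λ s → f s t ≡ true
  ∑-true (suc n) f t eq with f 0 t in eq₀
  ... | true  = 0 , eq₀
  ... | false = let s , eqₛ = ∑-true n (λ i → f (suc i)) t eq in suc s , eqₛ

  -- Multiples of 8 are written t * 2 * 2 * 2 so that square-even applies definitionally.
  eighth-coefficient : ∀ f t → eighth f (t ℕ.* 2 ℕ.* 2 ℕ.* 2) ≡ f t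
  eighth-coefficient f t = ≡.trans (square-even (f · f · (f · f)) (t ℕ.* 2 ℕ.* 2))
      (≡.trans (square-even (f · f) (t ℕ.* 2)) (square-even f t))

  -- Halving an exponent ≡ 2, 4 or 6 (mod 8) reaches an odd number before three halvings, and there
  -- a square has coefficient 0.
  eighth-2 : ∀ f t → eighth f (2 ℕ.+ t ℕ.* 2 ℕ.* 2 ℕ.* 2) ≡ false
  eighth-2 f t = ≡.trans (square-even (f · f · (f · f)) (1 ℕ.+ t ℕ.* 2 ℕ.* 2)) (square-odd (f · f) (t ℕ.* 2))

  eighth-4 : ∀ f t → eighth f (4 ℕ.+ t ℕ.* 2 ℕ.* 2 ℕ.* 2) ≡ false
  eighth-4 f t = ≡.trans (square-even (f · f · (f · f)) (2 ℕ.+ t ℕ.* 2 ℕ.* 2))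
      (≡.trans (square-even (f · f) (1 ℕ.+ t ℕ.* 2)) (square-odd f t))

  eighth-6 : ∀ f t → eighth f (6 ℕ.+ t ℕ.* 2 ℕ.* 2 ℕ.* 2) ≡ false
  eighth-6 f t = ≡.trans (square-even (f · f · (f · f)) (3 ℕ.+ t ℕ.* 2 ℕ.* 2)) (square-odd (f · f) (1 ℕ.+ t ℕ.* 2))

  q⁴eighth-2 : ∀ f t → (q^ 4 · eighth f) (2 ℕ.+ t ℕ.* 2 ℕ.* 2 ℕ.* 2) ≡ false
  -- At t = 0 the exponent 2 lies below the shift 4. Otherwise one multiple of 8 is borrowed,
  -- leaving residue 2 + 8 - 4 = 6.
  q⁴eighth-2 f zero    = ≡.refl
  q⁴eighth-2 f (suc t) = ≡.trans (q^-· 4 (eighth f) (6 ℕ.+ t ℕ.* 2 ℕ.* 2 ℕ.* 2)) (eighth-6 f t)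

  q⁶eighth-2 : ∀ f t → (q^ 6 · eighth f) (2 ℕ.+ t ℕ.* 2 ℕ.* 2 ℕ.* 2) ≡ false
  q⁶eighth-2 f zero    = ≡.refl
  q⁶eighth-2 f (suc t) = ≡.trans (q^-· 6 (eighth f) (4 ℕ.+ t ℕ.* 2 ℕ.* 2 ℕ.* 2)) (eighth-4 f t)

  q⁶eighth-4 : ∀ f t → (q^ 6 · eighth f) (4 ℕ.+ t ℕ.* 2 ℕ.* 2 ℕ.* 2) ≡ false
  q⁶eighth-4 f zero    = ≡.refl
  q⁶eighth-4 f (suc t) = ≡.trans (q^-· 6 (eighth f) (6 ℕ.+ t ℕ.* 2 ℕ.* 2 ℕ.* 2)) (eighth-6 f t)

  etaQuotA-2 : ∀ t → 2 ℕ.+ t ℕ.* 2 ℕ.* 2 ℕ.* 2 < K → mod₂ etaQuotA (2 ℕ.+ t ℕ.* 2 ℕ.* 2 ℕ.* 2) ≡ θ₁ t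
  etaQuotA-2 t <K = ≡.trans (coefficient etaQuotA-dissection <K) (≡.trans
    (≡.cong₂ _xor_ (≡.cong₂ _xor_ (≡.cong₂ _xor_ (eighth-2 (x · x · x · (θ₁ · θ₁ · θ₁)) t)
      (≡.trans (q^-· 2 (eighth θ₁) (t ℕ.* 2 ℕ.* 2 ℕ.* 2)) (eighth-coefficient θ₁ t))) (q⁴eighth-2 θ₃ t))
      (q⁶eighth-2 (x · x · x · (θ₃ · θ₃ · θ₃)) t))
    (≡.trans (Bool.xor-identityʳ _) (Bool.xor-identityʳ _)))

  etaQuotA-4 : ∀ t → 4 ℕ.+ t ℕ.* 2 ℕ.* 2 ℕ.* 2 < K → mod₂ etaQuotA (4 ℕ.+ t ℕ.* 2 ℕ.* 2 ℕ.* 2) ≡ θ₃ t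
  etaQuotA-4 t <K = ≡.trans (coefficient etaQuotA-dissection <K) (≡.trans
    (≡.cong₂ _xor_ (≡.cong₂ _xor_ (≡.cong₂ _xor_ (eighth-4 (x · x · x · (θ₁ · θ₁ · θ₁)) t)
      (≡.trans (q^-· 2 (eighth θ₁) (2 ℕ.+ t ℕ.* 2 ℕ.* 2 ℕ.* 2)) (eighth-2 θ₁ t)))
          (≡.trans (q^-· 4 (eighth θ₃) (t ℕ.* 2 ℕ.* 2 ℕ.* 2)) (eighth-coefficient θ₃ t)))
      (q⁶eighth-4 (x · x · x · (θ₃ · θ₃ · θ₃)) t))
    (Bool.xor-identityʳ _))

-- Arithmetic of the exponents

open import Data.Integer using (_+_; _*_)
open import Data.Integer.Divisibility using (_∣_)

≡ᵇ-true : ∀ m n → (m ℕ.≡ᵇ n) ≡ true → m ≡ n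
≡ᵇ-true m n eq = ℕ.≡ᵇ⇒≡ m n (≡.subst Bool.T (≡.sym eq) _)

J6*-parity : ∀ n → parity (J6* (+ suc n)) ≡ mod₂ etaQuotA (2 ℕ.+ n)
J6*-parity n = ≡.trans (parity-+ (etaQuotA (2 ℕ.+ n)) (+ 64 * etaQuotB n))
  (≡.trans (≡.cong (mod₂ etaQuotA (2 ℕ.+ n) xor_) (parity-* (+ 64) (etaQuotB n))) (Bool.xor-identityʳ _))

-- The pole shifts the index by one, to the exponent 2 + 8t of `etaQuotA`, where only q² θ₁⁸
-- contributes. An odd coefficient forces t = `tri s` for some s, whence 1 + 8t = (2s+1)².
J6*-odd-1 : ∀ t → parity (J6* (+ (1 ℕ.+ t ℕ.* 2 ℕ.* 2 ℕ.* 2))) ≡ true → ∃ λ y → 1 ℕ.+ t ℕ.* 2 ℕ.* 2 ℕ.* 2 ≡ y ℕ.* y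
J6*-odd-1 t odd = let s , eq = ∑-true K (λ s → q^ (tri s)) t θ₁-true in
  1 ℕ.+ s ℕ.* 2 , ≡.trans (≡.cong (λ t → 1 ℕ.+ t ℕ.* 2 ℕ.* 2 ℕ.* 2) (≡ᵇ-true t (tri s) eq))
    (≡.trans (≡.cong (λ x → 1 ℕ.+ x ℕ.* 2 ℕ.* 2) (tri-*2 s)) (square s))
  where
  -- The least truncation order that keeps the coefficient of q^(2 + 8t).
  K = 3 ℕ.+ t ℕ.* 2 ℕ.* 2 ℕ.* 2
  open EtaMod2 K
  θ₁-true = ≡.trans (≡.sym (etaQuotA-2 t ℕ.≤-refl)) (≡.trans (≡.sym (J6*-parity (t ℕ.* 2 ℕ.* 2 ℕ.* 2))) odd)
  square : ∀ s → 1 ℕ.+ s ℕ.* suc s ℕ.* 2 ℕ.* 2 ≡ (1 ℕ.+ s ℕ.* 2) ℕ.* (1 ℕ.+ s ℕ.* 2)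
  square = solve-∀

-- Here the exponent is 4 + 8t and only q⁴ θ₃⁸ contributes, so t = 3 `tri s` and 3 + 8t = 3(2s+1)².
J6*-odd-3 : ∀ t → parity (J6* (+ (3 ℕ.+ t ℕ.* 2 ℕ.* 2 ℕ.* 2))) ≡ true → ∃ λ y → 3 ℕ.+ t ℕ.* 2 ℕ.* 2 ℕ.* 2 ≡ 3 ℕ.* (y ℕ.* y)
J6*-odd-3 t odd = let s , eq = ∑-true K (λ s → q^ (3 ℕ.* tri s)) t θ₃-true in
  1 ℕ.+ s ℕ.* 2 , ≡.trans (≡.cong (λ t → 3 ℕ.+ t ℕ.* 2 ℕ.* 2 ℕ.* 2) (≡ᵇ-true t (3 ℕ.* tri s) eq))
    (≡.trans (assoc (tri s)) (≡.trans (≡.cong (λ x → 3 ℕ.+ 3 ℕ.* x ℕ.* 2 ℕ.* 2) (tri-*2 s)) (square s)))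
  where
  K = 5 ℕ.+ t ℕ.* 2 ℕ.* 2 ℕ.* 2
  open EtaMod2 K
  θ₃-true = ≡.trans (≡.sym (etaQuotA-4 t ℕ.≤-refl)) (≡.trans (≡.sym (J6*-parity (2 ℕ.+ t ℕ.* 2 ℕ.* 2 ℕ.* 2))) odd)
  assoc : ∀ x → 3 ℕ.+ 3 ℕ.* x ℕ.* 2 ℕ.* 2 ℕ.* 2 ≡ 3 ℕ.+ 3 ℕ.* (x ℕ.* 2) ℕ.* 2 ℕ.* 2
  assoc = solve-∀
  square : ∀ s → 3 ℕ.+ 3 ℕ.* (s ℕ.* suc s) ℕ.* 2 ℕ.* 2 ≡ 3 ℕ.* ((1 ℕ.+ s ℕ.* 2) ℕ.* (1 ℕ.+ s ℕ.* 2))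
  square = solve-∀

%8-split : ∀ n → n ≡ n % 8 ℕ.+ (n ℕ./ 8) ℕ.* 2 ℕ.* 2 ℕ.* 2
%8-split n = ≡.trans (ℕ.m≡m%n+[m/n]*n n 8) (≡.cong (n % 8 ℕ.+_) (lemma (n ℕ./ 8)))
  where
  lemma : ∀ t → t ℕ.* 8 ≡ t ℕ.* 2 ℕ.* 2 ℕ.* 2
  lemma = solve-∀

J6*-odd : ∀ m {u} → m ≤ 1 → u % 8 ≡ 1 → parity (J6* (+ (3 ^ m ℕ.* u))) ≡ true → ∃ λ y → u ≡ y ℕ.* y
J6*-odd zero {u} _ u%8≡1 odd =
  let y , eq = J6*-odd-1 (u ℕ./ 8) (≡.subst (λ N → parity (J6* (+ N)) ≡ true) u+0≡ odd) in y , ≡.trans u≡ eq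
  where
  u≡ = ≡.trans (%8-split u) (≡.cong (ℕ._+ (u ℕ./ 8) ℕ.* 2 ℕ.* 2 ℕ.* 2) u%8≡1)
  u+0≡ = ≡.trans (ℕ.+-identityʳ u) u≡
J6*-odd (suc zero) {u} _ u%8≡1 odd =
  let y , eq = J6*-odd-3 ((3 ℕ.* u) ℕ./ 8) (≡.subst (λ N → parity (J6* (+ N)) ≡ true) 3u≡ odd) in
  y , ℕ.*-cancelˡ-≡ u (y ℕ.* y) 3 (≡.trans 3u≡ eq)
  where
  3u%8≡3 : (3 ℕ.* u) % 8 ≡ 3
  3u%8≡3 = ≡.trans (ℕ.%-distribˡ-* 3 u 8) (≡.cong (λ r → (3 ℕ.* r) % 8) u%8≡1)
  3u≡ = ≡.trans (%8-split (3 ℕ.* u)) (≡.cong (ℕ._+ ((3 ℕ.* u) ℕ./ 8) ℕ.* 2 ℕ.* 2 ℕ.* 2) 3u%8≡3)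
J6*-odd (suc (suc m)) (s≤s ()) _ _

-- Parity of the p-adic valuation of a square

prime-∣-square : ∀ {p} n → Prime p → p ℕ.∣ n ℕ.* n → p ℕ.∣ n
prime-∣-square n p-prime p∣n² = [ id , id ]′ (euclidsLemma n n p-prime p∣n²)

-- Were c prime to p, the left side would have odd p-adic valuation. The argument is an infinite
-- descent on s: p divides y, hence s² c, and if it divides s then p² cancels from both sides,
-- leaving a smaller s.
square-valuation : ∀ {p} → Prime p → ∀ c s y → s ≢ 0 → s ℕ.* s ℕ.* (p ℕ.* c) ≡ y ℕ.* y → p ℕ.∣ c
square-valuation {p} p-prime c = <-rec _ step
  where
  instance _ = prime⇒nonZero p-prime

  step : ∀ s → (∀ {s′} → s′ < s → ∀ y → s′ ≢ 0 → s′ ℕ.* s′ ℕ.* (p ℕ.* c) ≡ y ℕ.* y → p ℕ.∣ c) →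
    ∀ y → s ≢ 0 → s ℕ.* s ℕ.* (p ℕ.* c) ≡ y ℕ.* y → p ℕ.∣ c
  step s rec y s≢0 eq with prime-∣-square y p-prime (≡.subst (p ℕ.∣_) eq (ℕ.∣n⇒∣m*n (s ℕ.* s) (ℕ.m∣m*n c)))
  ... | ℕ.divides y′ ≡.refl = [ descend , id ]′ (euclidsLemma (s ℕ.* s) c p-prime (ℕ.divides (y′ ℕ.* y′) eq′))
    where
    lemma₁ : ∀ s p c → s ℕ.* s ℕ.* (p ℕ.* c) ≡ s ℕ.* s ℕ.* c ℕ.* p
    lemma₁ = solve-∀
    lemma₂ : ∀ y p → y ℕ.* p ℕ.* (y ℕ.* p) ≡ y ℕ.* y ℕ.* p ℕ.* p
    lemma₂ = solve-∀
    lemma₃ : ∀ s p c → s ℕ.* p ℕ.* (s ℕ.* p) ℕ.* c ≡ s ℕ.* s ℕ.* (p ℕ.* c) ℕ.* p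
    lemma₃ = solve-∀

    eq′ : s ℕ.* s ℕ.* c ≡ y′ ℕ.* y′ ℕ.* p
    eq′ = ℕ.*-cancelʳ-≡ _ _ p (≡.trans (≡.sym (lemma₁ s p c)) (≡.trans eq (lemma₂ y′ p)))

    descend : p ℕ.∣ s ℕ.* s → p ℕ.∣ c
    descend p∣s² with prime-∣-square s p-prime p∣s²
    ... | p∣s@(ℕ.divides s′ ≡.refl) = rec (ℕ.quotient-< p∣s {{prime⇒nonTrivial p-prime}} {{ℕ.≢-nonZero s≢0}}) y′
        (λ s′≡0 → s≢0 (≡.cong (ℕ._* p) s′≡0))
      (ℕ.*-cancelʳ-≡ _ _ p (≡.trans (≡.sym (lemma₃ s′ p c)) eq′))

1%8-* : ∀ a b → a % 8 ≡ 1 → b % 8 ≡ 1 → (a ℕ.* b) % 8 ≡ 1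
1%8-* a b a%8≡1 b%8≡1 = ≡.trans (ℕ.%-distribˡ-* a b 8) (≡.cong₂ (λ x y → (x ℕ.* y) % 8) a%8≡1 b%8≡1)

-- The residues 3, 5 and 7 all square to 1 modulo 8. It serves both the squares p_i² and the product
-- of p_{k+1} with its cofactor.
admissible-*%8 : ∀ {p} c → Admissible p → c % 8 ≡ p % 8 → (p ℕ.* c) % 8 ≡ 1
admissible-*%8 {p} c (_ , p%8) c≡p = ≡.trans (ℕ.%-distribˡ-* p c 8)
  (≡.trans (≡.cong (λ x → (p % 8 ℕ.* x) % 8) c≡p) (square p%8))
  where
  square : ∀ {r} → r ≡ 3 ⊎ r ≡ 5 ⊎ r ≡ 7 → (r ℕ.* r) % 8 ≡ 1
  square (inj₁ ≡.refl)        = ≡.refl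
  square (inj₂ (inj₁ ≡.refl)) = ≡.refl
  square (inj₂ (inj₂ ≡.refl)) = ≡.refl

admissible-∤2 : ∀ {p} → Admissible p → ¬ p ℕ.∣ 2
admissible-∤2 {0}                 (_ , inj₁ ())
admissible-∤2 {0}                 (_ , inj₂ (inj₁ ()))
admissible-∤2 {0}                 (_ , inj₂ (inj₂ ()))
admissible-∤2 {1}                 (_ , inj₁ ())
admissible-∤2 {1}                 (_ , inj₂ (inj₁ ()))
admissible-∤2 {1}                 (_ , inj₂ (inj₂ ()))
admissible-∤2 {2}                 (_ , inj₁ ())
admissible-∤2 {2}                 (_ , inj₂ (inj₁ ()))
admissible-∤2 {2}                 (_ , inj₂ (inj₂ ()))
admissible-∤2 {suc (suc (suc p))} _ p∣2 with ℕ.∣⇒≤ p∣2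
... | s≤s (s≤s ())

admissible-∣8* : ∀ {p} n → Admissible p → p ℕ.∣ 8 ℕ.* n → p ℕ.∣ n
admissible-∣8* {p} n p-adm@(p-prime , _) p∣8n = cancel2 n (cancel2 (2 ℕ.* n) (cancel2 (2 ℕ.* (2 ℕ.* n)) (≡.subst (p ℕ.∣_) (lemma n) p∣8n)))
  where
  cancel2 : ∀ n → p ℕ.∣ 2 ℕ.* n → p ℕ.∣ n
  cancel2 n p∣2n = [ (λ p∣2 → contradiction p∣2 (admissible-∤2 p-adm)) , id ]′ (euclidsLemma 2 n p-prime p∣2n)
  lemma : ∀ n → 8 ℕ.* n ≡ 2 ℕ.* (2 ℕ.* (2 ℕ.* n))
  lemma = solve-∀

prodSq-%8 : ∀ {k} (ps : Vec ℕ k) → All Admissible ps → prodSq ps % 8 ≡ 1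
prodSq-%8 []       []             = ≡.refl
prodSq-%8 (p ∷ ps) (p-adm ∷ ps-adm) = 1%8-* (p ℕ.* p) (prodSq ps) (admissible-*%8 p p-adm ≡.refl) (prodSq-%8 ps ps-adm)

prodSq-square : ∀ {k} (ps : Vec ℕ k) → ∃ λ s → prodSq ps ≡ s ℕ.* s
prodSq-square []       = 1 , ≡.refl
prodSq-square (p ∷ ps) = let s , eq = prodSq-square ps in
  p ℕ.* s , ≡.trans (≡.cong (p ℕ.* p ℕ.*_) eq) (lemma p s)
  where
  lemma : ∀ p s → p ℕ.* p ℕ.* (s ℕ.* s) ≡ p ℕ.* s ℕ.* (p ℕ.* s)
  lemma = solve-∀

difference : ∀ j → ∃ λ a → ∃ λ b → j ≡ + a ℤ.- + b
difference (+ a)    = a , 0 , ≡.sym (ℤ.+-identityʳ (+ a))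
difference -[1+ b ] = 0 , suc b , ≡.refl

-- As j may be negative, it is written a - b and 8b is moved to the other side, which leaves an
-- equation between natural numbers.
+8-multiples-%8 : ∀ {c p} m j → + c ≡ + (8 ℕ.* m) + + 8 * j + + p → c % 8 ≡ p % 8
+8-multiples-%8 {c} {p} m j eq with difference j
... | a , b , ≡.refl = ≡.trans (≡.sym (ℕ.[m+kn]%n≡m%n c b 8)) (≡.trans (≡.cong (_% 8) eqℕ) (ℕ.[m+kn]%n≡m%n p (m ℕ.+ a) 8))
  where
  lemma : ∀ m a b p → + 8 * m + + 8 * (a ℤ.- b) + p + b * + 8 ≡ p + (m + a) * + 8
  lemma = ℤ-solve-∀

  open ≡.≡-Reasoning
  eqℕ : c ℕ.+ b ℕ.* 8 ≡ p ℕ.+ (m ℕ.+ a) ℕ.* 8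
  eqℕ = ℤ.+-injective (begin
    + c + + (b ℕ.* 8)                                                ≡⟨ ≡.cong₂ _+_ eq (ℤ.pos-* b 8) ⟩
    + (8 ℕ.* m) + + 8 * (+ a ℤ.- + b) + + p + + b * + 8
        ≡⟨ ≡.cong (λ x → x + + 8 * (+ a ℤ.- + b) + + p + + b * + 8) (ℤ.pos-* 8 m) ⟩
    + 8 * + m + + 8 * (+ a ℤ.- + b) + + p + + b * + 8                ≡⟨ lemma (+ m) (+ a) (+ b) (+ p) ⟩
    + p + (+ m + + a) * + 8                                          ≡⟨ ≡.cong (λ x → + p + x) (ℤ.pos-* (m ℕ.+ a) 8) ⟨
    + p + + ((m ℕ.+ a) ℕ.* 8)                                        ∎)

-- Modulo p the cofactor is 8j, and p is odd.
∤-factor : ∀ {p} n j → Admissible p → ¬ (+ p ∣ j) → ¬ (+ p ∣ + (8 ℕ.* p ℕ.* n) + + 8 * j + + p)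
∤-factor {p} n j p-adm p∤j p∣c = p∤j (admissible-∣8* ∣ j ∣ p-adm (≡.subst (p ℕ.∣_) (ℤ.abs-* (+ 8) j) (Signed.∣⇒∣ᵤ p∣8j)))
  where
  p∣8j : + p Signed.∣ + 8 * j
  p∣8j = Signed.∣m+n∣m⇒∣n {m = + (8 ℕ.* p ℕ.* n)}
    (Signed.∣m+n∣n⇒∣m {m = + (8 ℕ.* p ℕ.* n) + + 8 * j} (Signed.∣ᵤ⇒∣ p∣c) (Signed.∣ᵤ⇒∣ {+ p} {+ p} ℕ.∣-refl))
    (Signed.∣ᵤ⇒∣ {+ p} (ℕ.∣m⇒∣m*n n (ℕ.n∣m*n 8)))

-- A negative j can make the index negative. The bound on x keeps it at -2 or less, away from the
-- pole at -1, whose coefficient is odd.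
J6*-negative : ∀ x c → 2 ≤ x → J6* (+ x * -[1+ c ]) ≡ + 0
J6*-negative (suc (suc x)) zero    _ = ≡.refl
J6*-negative (suc (suc x)) (suc c) _ = ≡.refl
J6*-negative (suc zero)    _       (s≤s ())

theorem1p2 : (k n : ℕ) (ps : Vec ℕ k) (p : ℕ) → All Admissible ps → Admissible p →
    (j : ℤ) → ¬ (+ p ∣ j) → (m : ℕ) → m ≤ 1 →
    + 2 ∣ J6* (+ (3 ^ m ℕ.* prodSq ps ℕ.* p) * (+ (8 ℕ.* p ℕ.* n) + + 8 * j + + p))
theorem1p2 k n ps p ps-adm p-adm@(p-prime , _) j p∤j m m≤1
  with + (8 ℕ.* p ℕ.* n) + + 8 * j + + p in eq | ∤-factor n j p-adm p∤j
-- A zero cofactor would be divisible by p.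
... | + zero   | p∤c = contradiction (p ℕ.∣0) p∤c
... | -[1+ c ] | _   = ≡.subst (+ 2 ∣_) (≡.sym (J6*-negative (3 ^ m ℕ.* prodSq ps ℕ.* p) c 2≤X)) (2 ℕ.∣0)
  where
  P≢0 : prodSq ps ≢ 0
  P≢0 P≡0 with ≡.trans (≡.sym (prodSq-%8 ps ps-adm)) (≡.cong (_% 8) P≡0)
  ... | ()
  instance
    _ = prime⇒nonZero p-prime
    _ = ℕ.≢-nonZero P≢0
    _ = ℕ.m^n≢0 3 m
    _ = ℕ.m*n≢0 (3 ^ m) (prodSq ps)
  2≤X : 2 ≤ 3 ^ m ℕ.* prodSq ps ℕ.* p
  2≤X = ℕ.≤-trans (ℕ.nonTrivial⇒n>1 p {{prime⇒nonTrivial p-prime}}) (ℕ.m≤n*m p (3 ^ m ℕ.* prodSq ps))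
... | + suc c  | p∤c = odd≡false⇒2∣ _ (≡.subst (λ i → parity (J6* i) ≡ false) (≡.sym index) (Bool.¬-not even))
  where
  C P u : ℕ
  C = suc c
  P = prodSq ps
  u = P ℕ.* (p ℕ.* C)

  assoc : ∀ a b c d → a ℕ.* b ℕ.* c ℕ.* d ≡ a ℕ.* (b ℕ.* (c ℕ.* d))
  assoc = solve-∀

  index : + (3 ^ m ℕ.* P ℕ.* p) * + C ≡ + (3 ^ m ℕ.* u)
  index = ≡.trans (≡.sym (ℤ.pos-* (3 ^ m ℕ.* P ℕ.* p) C)) (≡.cong +_ (assoc (3 ^ m) P p C))

  C%8≡p%8 : C % 8 ≡ p % 8
  C%8≡p%8 = +8-multiples-%8 (p ℕ.* n) j (≡.trans (≡.sym eq) (≡.cong (λ x → + x + + 8 * j + + p) (ℕ.*-assoc 8 p n)))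

  u%8≡1 : u % 8 ≡ 1
  u%8≡1 = 1%8-* P (p ℕ.* C) (prodSq-%8 ps ps-adm) (admissible-*%8 C p-adm C%8≡p%8)

  -- An odd coefficient would make u = s² p C a perfect square, where s² is `prodSq ps`; that forces
  -- p to divide C.
  even : parity (J6* (+ (3 ^ m ℕ.* u))) ≢ true
  even odd =
    let s , P≡s² = prodSq-square ps
        y , u≡y² = J6*-odd m m≤1 u%8≡1 odd
        s≢0 : s ≢ 0
        s≢0 s≡0 = ℕ.0≢1+n (≡.trans (≡.sym (≡.cong (λ s → (s ℕ.* s) % 8) s≡0)) (≡.trans (≡.sym (≡.cong (_% 8) P≡s²)) (prodSq-%8 ps ps-adm)))
    in p∤c (square-valuation p-prime C s y s≢0 (≡.trans (≡.cong (ℕ._* (p ℕ.* C)) (≡.sym P≡s²)) u≡y²))
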